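{- Let $\theta:\mathrm{QSym}\to\mathrm{QSym}$ be the unique morphism of combinatorial Hopf algebras $(\mathrm{QSym},\gamma)\to(\mathrm{QSym},\zeta)$, let $\mathcal{G}|_{\mathrm{Mat}}$ be the restriction of $\mathcal{G}$ to $\mathrm{Mat}$, and let $\mathcal{F}:\mathrm{Mat}\to\mathrm{QSym}$ be the Billera–Jia–Reiner morphism. Then $\theta\circ\mathcal{G}|_{\mathrm{Mat}}=\mathcal{F}$.
   Context: A polymatroid is ${\bf X}=(X,\operatorname{rk})$, $X$ finite, $\operatorname{rk}$ from subsets of $X$ to $\{0,1,2,\dots\}$ with $\operatorname{rk}(\emptyset)=0$, monotone and submodular; it is a matroid if $\operatorname{rk}(\{x\})\in\{0,1\}$ for all $x$. Restriction: ${\bf X}|_A=(A,\operatorname{rk}|_A)$; contraction: ${\bf X}/A=(X\setminus A,\operatorname{rk}')$ with $\operatorname{rk}'(B)=\operatorname{rk}(A\cup B)-\operatorname{rk}(A)$; direct sum ${\bf X}\oplus{\bf Y}$ on $X\sqcup Y$ with $\operatorname{rk}(A\cup B)=\operatorname{rk}_X(A)+\operatorname{rk}_Y(B)$. $\mathrm{PolyMat}$ is the $\mathbb{Q}$-vector space with basis the isomorphism classes $[{\bf X}]$ of polymatroids, graded by $|X|$, with product $[{\bf X}][{\bf Y}]=[{\bf X}\oplus{\bf Y}]$, coproduct $\Delta[{\bf X}]=\sum_{A\subseteq X}[{\bf X}|_A]\otimes[{\bf X}/A]$, unit $[\emptyset]$ and counit $\epsilon[{\bf X}]=1$ if $X=\emptyset$,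 $0$ otherwise; it is a graded connected Hopf algebra. $\mathrm{Mat}$ is its sub-Hopf algebra spanned by matroids. $\mathrm{NSym}=\mathbb{Q}\langle p_1,p_2,\dots\rangle$ with $\Delta p_i=p_i\otimes1+1\otimes p_i$; for a sequence $\alpha=(\alpha_1,\dots,\alpha_r)$ of positive integers, $p_\alpha=p_{\alpha_1}\cdots p_{\alpha_r}$, $\ell(\alpha)=r$, $|\alpha|=\sum\alpha_i$. $\mathrm{QSym}$ is the graded dual Hopf algebra with basis $\{P_\alpha\}$ dual to $\{p_\alpha\}$; thus $P_\alpha P_\beta=\sum_\gamma P_\gamma$ over all $\binom{\ell(\alpha)+\ell(\beta)}{\ell(\alpha)}$ shuffles $\gamma$ of $\alpha,\beta$ and $\Delta P_\alpha=\sum_{\beta\gamma=\alpha}P_\beta\otimes P_\gamma$ (concatenation). It is identified with the quasi-symmetric functions via $P_\beta=\sum M_{(|\beta_1|,\dots,|\beta_r|)}/(\ell(\beta_1)!\cdots\ell(\beta_r)!)$, summing over all factorizations $\beta=\beta_1\beta_2\cdots\beta_r$ into nonempty consecutive pieces, where $M_\alpha=\sum_{i_1<\dots<i_r}x_{i_1}^{\alpha_1}\cdots x_{i_r}^{\alpha_r}$. For a sequence $a=(a_1,\dots,a_d)$ of nonnegative integers set $U_a=P_{(a_1+1,\dots,a_d+1)}$. For a polymatroid with $|X|=d$, $\mathcal{G}[{\bf X}]=\sum_{\underline X}U_{r(\underline X)}$ over all $d!$ maximal chains $\underline X:\emptyset=X_0\subset X_1\subset\cdots\subset X_d=X$ ($|X_i|=i$),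 where $r(\underline X)=(\operatorname{rk}(X_1)-\operatorname{rk}(X_0),\dots,\operatorname{rk}(X_d)-\operatorname{rk}(X_{d-1}))$; $\mathcal{G}$ is extended $\mathbb{Q}$-linearly to $\mathrm{PolyMat}$. A combinatorial Hopf algebra is a pair $(\mathcal{H},\zeta')$ with $\mathcal{H}=\bigoplus_{d\ge0}\mathcal{H}_d$ a graded Hopf algebra over $\mathbb{Q}$ with $\mathcal{H}_0=\mathbb{Q}$, each $\mathcal{H}_d$ finite-dimensional, and $\zeta':\mathcal{H}\to\mathbb{Q}$ an algebra homomorphism; a morphism $(\mathcal{H}',\zeta'')\to(\mathcal{H},\zeta')$ is a graded Hopf algebra morphism $\varphi$ with $\zeta'\circ\varphi=\zeta''$. Let $\zeta:\mathrm{QSym}\to\mathbb{Q}$ be the character with $\zeta(M_\alpha)=1$ if $\ell(\alpha)\le1$ and $0$ otherwise; $(\mathrm{QSym},\zeta)$ is a terminal object (Aguiar–Bergeron–Sottile): every combinatorial Hopf algebra has a unique morphism to it. Let $\zeta_{\mathrm{Mat}}([{\bf X}])=1$ if ${\bf X}$ is isomorphic to a direct sum of loops (one element of rank $0$) and coloops (one element of rank $1$), and $0$ otherwise; $\mathcal{F}$ is the unique morphism $(\mathrm{Mat},\zeta_{\mathrm{Mat}})\to(\mathrm{QSym},\zeta)$. Let $\gamma:\mathrm{QSym}\to\mathbb{Q}$ be the linear map with $\gamma(P_\alpha)=0$ if $\alpha$ is not weakly increasing, and, if $\alpha=(a_1^{k_1},\dots,a_s^{k_s})$ with $a_1<\dots<a_s$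 (meaning $a_j$ repeated $k_j$ times), $\gamma(P_\alpha)=1/(k_1!\cdots k_s!)$ (in particular $\gamma(P_{()})=1$); $\gamma$ is an algebra homomorphism, so $(\mathrm{QSym},\gamma)$ is a combinatorial Hopf algebra.
   Formalization: θ is taken with the source QSym graded by deg P_β = ℓ(β); with the usual grading |β| the identity fails for a coloop (M_2 versus M_1). θ and 𝓕 are given by the explicit Aguiar–Bergeron–Sottile formula. -}

module Defs where

open import Data.Nat as ℕ using (ℕ; zero; suc; _≤_; _∸_; _!; NonZero)
open import Data.Nat.Properties using (_!≢0)
open import Data.Bool using (Bool; true; false; _∧_; if_then_else_)
open import Data.Fin using (Fin)
open import Data.Fin.Subset using (Subset; ⊥; ⊤; ⁅_⁆; _∪_; _∩_; _⊆_; ∣_∣)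
open import Data.Fin.Subset.Properties using (_⊆?_)
open import Data.Vec using ([]; _∷_)
open import Data.Vec.Properties using (≡-dec)
open import Data.List using (List; []; _∷_; map; concatMap; foldr; length; allFin)
open import Data.Bool.ListAction using (any; all)
open import Data.Rational as ℚ using (ℚ; 0ℚ; 1ℚ)
open import Data.Integer using (+_)
open import Relation.Nullary.Decidable using (does)
open import Relation.Binary.PropositionalEquality using (_≡_)

record Matroid (n : ℕ) : Set where
  field
    rk      : Subset n → ℕ
    rk-∅    : rk ⊥ ≡ 0
    rk-mono : ∀ {A B} → A ⊆ B → rk A ≤ rk B
    rk-sub  : ∀ A B → rk (A ∪ B) ℕ.+ rk (A ∩ B) ≤ rk A ℕ.+ rk B
    rk-pt   : ∀ x → rk ⁅ x ⁆ ≤ 1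

sumℚ : List ℚ → ℚ
sumℚ = foldr ℚ._+_ 0ℚ

prodℚ : List ℚ → ℚ
prodℚ = foldr ℚ._*_ 1ℚ

bool→ℚ : Bool → ℚ
bool→ℚ true  = 1ℚ
bool→ℚ false = 0ℚ

_==ℕ_ : ℕ → ℕ → Bool
m ==ℕ n = does (m ℕ.≟ n)

_==S_ : ∀ {n} → Subset n → Subset n → Bool
A ==S B = does (≡-dec Data.Bool._≟_ A B)

_⊆ᵇ_ : ∀ {n} → Subset n → Subset n → Bool
A ⊆ᵇ B = does (A ⊆? B)

allSubsets : ∀ n → List (Subset n)
allSubsets zero    = [] ∷ []
allSubsets (suc n) = map (true ∷_) (allSubsets n) Data.List.++ map (false ∷_) (allSubsets n)

insertions : ∀ {A : Set} → A → List A → List (List A)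
insertions x []       = (x ∷ []) ∷ []
insertions x (y ∷ ys) = (x ∷ y ∷ ys) ∷ map (y ∷_) (insertions x ys)

perms : ∀ {A : Set} → List A → List (List A)
perms []       = [] ∷ []
perms (x ∷ xs) = concatMap (insertions x) (perms xs)

-- QSym.  An element of QSym is recorded by its coefficients in the
-- monomial basis M_α (α a composition, i.e. a list of positive naturals).
-- Elements of the P-basis are indexed by lists of positive naturals β.

-- The map 𝒢 on a matroid: 𝒢[X] = Σ_{maximal chains} U_{r(chain)},
-- U_a = P_{(a₁+1,…,a_d+1)}.  Maximal chains ∅ = X₀ ⊂ X₁ ⊂ … ⊂ X_d = X
-- correspond bijectively to orderings (x₁,…,x_d) of X, X_i = {x₁,…,x_i}.
-- We return the list (with multiplicity, each with coefficient 1) of the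
-- indices β of the P-basis elements occurring.

rankIncrements : ∀ {n} → (Subset n → ℕ) → Subset n → List (Fin n) → List ℕ
rankIncrements rk acc []       = []
rankIncrements rk acc (x ∷ xs) =
  (rk (acc ∪ ⁅ x ⁆) ∸ rk acc) ∷ rankIncrements rk (acc ∪ ⁅ x ⁆) xs

U-index : List ℕ → List ℕ
U-index a = map suc a

𝒢-terms : ∀ {n} → Matroid n → List (List ℕ)
𝒢-terms {n} M =
  map (λ o → U-index (rankIncrements (Matroid.rk M) ⊥ o)) (perms (allFin n))

-- The character γ on QSym (values on the P-basis).

runs : List ℕ → List ℕ
runs []       = []
runs (x ∷ xs) = go x 1 xs
  where
  go : ℕ → ℕ → List ℕ → List ℕ
  go y k []       = k ∷ []
  go y k (z ∷ zs) = if y ==ℕ z then go y (suc k) zs else k ∷ go z 1 zs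

weaklyIncreasing : List ℕ → Bool
weaklyIncreasing []           = true
weaklyIncreasing (x ∷ [])     = true
weaklyIncreasing (x ∷ y ∷ xs) = does (x ℕ.≤? y) ∧ weaklyIncreasing (y ∷ xs)

inv! : ℕ → ℚ
inv! k = (+ 1) ℚ./ (k !) where instance _ = k !≢0

γ : List ℕ → ℚ
γ β = if weaklyIncreasing β then prodℚ (map inv! (runs β)) else 0ℚ

-- θ : (QSym, γ) → (QSym, ζ), by the Aguiar–Bergeron–Sottile formula
--   θ(h) = Σ_α γ_α(h) M_α,   γ_α = (γ_{α₁} ⊗ … ⊗ γ_{α_k}) ∘ Δ^{(k-1)},
-- where γ_i is γ restricted to the degree-i component of the source.
-- The source (QSym, γ) is graded so that 𝒢 is graded, i.e. deg P_β = ℓ(β).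
-- Δ^{(k-1)} P_β = Σ over deconcatenations β = β₁⋯β_k (pieces may be empty).

deconcat : ℕ → List ℕ → List (List (List ℕ))
deconcat zero    []       = [] ∷ []
deconcat zero    (_ ∷ _)  = []
deconcat (suc k) β        = concatMap (λ p → map (Data.List.take p β ∷_) (deconcat k (Data.List.drop p β)))
                                      (Data.List.upTo (suc (length β)))

θ-coeff : List ℕ → List ℕ → ℚ
θ-coeff β α =
  sumℚ (map (λ pieces → if lengthsEq pieces α then prodℚ (map γ pieces) else 0ℚ)
            (deconcat (length α) β))
  where
  lengthsEq : List (List ℕ) → List ℕ → Bool
  lengthsEq []       []       = true
  lengthsEq (p ∷ ps) (a ∷ as) = (length p ==ℕ a) ∧ lengthsEq ps as
  lengthsEq _        _        = false

θ𝒢-coeff : ∀ {n} → Matroid n → List ℕ → ℚ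
θ𝒢-coeff M α = sumℚ (map (λ β → θ-coeff β α) (𝒢-terms M))

-- ℱ : (Mat, ζ_Mat) → (QSym, ζ), by the same formula:
--   ℱ[X] = Σ_α ζ_α[X] M_α,  Δ^{(k-1)}[X] = Σ_{∅=A₀⊆A₁⊆…⊆A_k=X} ⊗_i [(X|A_i)/A_{i-1}],
-- and the projection to degrees α keeps the chains with |A_i ∖ A_{i-1}| = α_i.

-- ζ_Mat of the minor (X|(A ∪ B))/A on ground set B (A, B disjoint):
-- rank rk'(S) = rk(A ∪ S) − rk(A) for S ⊆ B.  It is isomorphic to a direct
-- sum of loops and coloops iff for some C ⊆ B (the coloops, B ∖ C the loops)
-- rk'(S) = |S ∩ C| for all S ⊆ B.
ζ-minor : ∀ {n} → Matroid n → Subset n → Subset n → Bool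
ζ-minor {n} M A B =
  any (λ C → (C ⊆ᵇ B) ∧
             all (λ S → if S ⊆ᵇ B then (rk (A ∪ S) ∸ rk A) ==ℕ ∣ S ∩ C ∣ else true)
                 (allSubsets n))
      (allSubsets n)
  where open Matroid M

-- sequences of blocks (B₁,…,B_k), B_i = A_i ∖ A_{i-1}, with |B_i| = α_i,
-- starting from the current set A and ending with the whole ground set.
flags : ∀ {n} → Subset n → List ℕ → List (List (Subset n))
flags A []      = if A ==S ⊤ then [] ∷ [] else []
flags {n} A (a ∷ α) =
  concatMap (λ B → map (B ∷_) (flags (A ∪ B) α))
            (Data.List.filter (λ B → ∣ B ∣ ℕ.≟ a) (Data.List.filter (λ B → ≡-dec Data.Bool._≟_ (A ∩ B) ⊥) (allSubsets n)))

ζ-flag : ∀ {n} → Matroid n → Subset n → List (Subset n) → ℚ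
ζ-flag M A []      = 1ℚ
ζ-flag M A (B ∷ Bs) = bool→ℚ (ζ-minor M A B) ℚ.* ζ-flag M (A ∪ B) Bs

ℱ-coeff : ∀ {n} → Matroid n → List ℕ → ℚ
ℱ-coeff M α = sumℚ (map (ζ-flag M ⊥) (flags ⊥ α))

{-# OPTIONS --safe #-}

-- An ordering of X compatible with a composition α is the same as a flag of
-- blocks B₁, …, B_k with |B_i| = α_i together with an ordering of each block, so
-- the M_α-coefficient of θ(𝒢[X]) is the sum over flags of the products over i of
--   Σ_{orderings of B_i} γ(rank increments over A = B₁ ∪ … ∪ B_{i-1}).
-- It remains to see that each factor is ζ_Mat of the minor (X|(A ∪ B))/A.
-- If the minor is a sum of loops and coloops, the increment of x does not depend
-- on the ordering, and the factor is 1 because Σ γ over all insertions of x into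
-- β is γ(β), i.e. γ(P_(x) P_β) = γ(P_β).  Conversely a single ordering with weakly
-- increasing increments 0⋯01⋯1 forces, by submodularity, the rank of every subset
-- S of B in the minor to be the number of its elements with increment 1; so if the
-- minor is not such a sum, every term vanishes.

module Submission where

open import Defs
open import Data.Bool as Bool using (Bool; true; false; if_then_else_; _∧_; _∨_; T)
open import Data.Bool.Properties using (T-≡; T-∧)
open import Data.Empty using (⊥-elim)
open import Data.Fin using (Fin; zero; suc)
open import Data.Fin.Properties using (suc-injective)
open import Data.Fin.Subset using (Subset; ⊥; ⊤; ⁅_⁆; _∪_; _∩_; _⊆_; ∁; ∣_∣) renaming (_∈_ to _∈ˢ_; _∉_ to _∉ˢ_)
open import Data.Fin.Subset.Properties using (_∈?_; _⊆?_; ∪-assoc; ∪-identityˡ; ∪-identityʳ; p⊆p∪q; q⊆p∪q; x∈p∪q⁺; x∈p∪q⁻; x∈p∩q⁺; x∈⁅x⁆; x∈⁅y⁆⇒x≡y; x≢y⇒x∉⁅y⁆; ∉⊥; ⊆-antisym)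
open import Data.Integer as ℤ using () renaming (+_ to pos)
import Data.Integer.Properties as ℤ
open import Data.List using (List; []; _∷_; _++_; map; concatMap; length; take; drop; upTo; filter; allFin)
open import Data.List.Membership.Propositional using (_∈_)
open import Data.List.Membership.Propositional.Properties using (∈-map⁺; ∈-map⁻; ∈-concatMap⁻; ∈-filter⁺; ∈-filter⁻; ∈-++⁺ˡ; ∈-++⁺ʳ)
open import Data.List.Properties using (map-∘; map-cong; map-cong-local; map-applyUpTo; map-tabulate; ∷-injective)
open import Data.List.Relation.Binary.Permutation.Propositional using (_↭_; ↭-refl; ↭-sym; ↭-trans; prep; swap; ↭⇒↭ₛ)
open import Data.List.Relation.Binary.Permutation.Propositional.Properties using (∈-resp-↭; ¬x∷xs↭[])
open import Data.List.Relation.Binary.Permutation.Setoid.Properties using (Unique-resp-↭)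
open import Data.List.Relation.Binary.Sublist.Propositional using ([]; _∷_; _∷ʳ_; lookup; minimum) renaming (_⊆_ to _⊑_)
open import Data.List.Relation.Binary.Sublist.Propositional.Properties using (All-resp-⊆; filter-⊆)
open import Data.List.Relation.Unary.All as All using (All; []; _∷_)
import Data.List.Relation.Unary.All.Properties as All
open import Data.List.Relation.Unary.AllPairs using ([]; _∷_)
open import Data.List.Relation.Unary.Any as Any using (Any; here; there; satisfied)
open import Data.List.Relation.Unary.Any.Properties using (any⁺; any⁻)
open import Data.List.Relation.Unary.Unique.Propositional using (Unique)
import Data.List.Relation.Unary.Unique.Propositional.Properties as Unique
open import Data.Nat as ℕ using (ℕ; zero; suc; _≤_; _∸_; _!; NonZero)
open import Data.Nat.ListAction using (sum)
import Data.Nat.Properties as ℕ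
open import Data.Product using (∃; _×_; _,_; proj₁; proj₂)
open import Data.Rational as ℚ using (ℚ; 0ℚ; 1ℚ; _+_; _*_)
open import Data.Rational.Properties using (+-assoc; +-comm; +-identityˡ; +-identityʳ; *-comm; *-identityˡ; *-zeroʳ; *-distribˡ-+; toℚᵘ-injective; toℚᵘ-homo-*; toℚᵘ-homo-+; toℚᵘ-fromℚᵘ)
open import Data.Rational.Solver using (module +-*-Solver)
import Data.Rational.Unnormalised as ℚᵘ
import Data.Rational.Unnormalised.Properties as ℚᵘ
open import Data.Sum using (inj₁; inj₂; [_,_]′)
open import Data.Vec as Vec using ([]; _∷_; here; there)
open import Data.Vec.Properties using (≡-dec; []=⇒lookup; lookup⇒[]=; lookup-zipWith)
open import Function using (_∘_; id)
open import Function.Bundles using (Equivalence)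
open import Relation.Binary.Definitions using (tri<; tri≈; tri>)
open import Relation.Binary.PropositionalEquality using (_≡_; _≢_; refl; sym; trans; cong; cong₂; subst; setoid; module ≡-Reasoning)
open import Relation.Nullary using (yes; no; contradiction)
open import Relation.Nullary.Decidable using (does; dec-true; dec-false)
open import Relation.Unary using (Decidable)

private variable
  X Y : Set
  n : ℕ

-- Finite sums of rationals.

∑ : List X → (X → ℚ) → ℚ
∑ xs f = sumℚ (map f xs)

∑-cong : ∀ (xs : List X) {f g : X → ℚ} → (∀ x → f x ≡ g x) → ∑ xs f ≡ ∑ xs g
∑-cong xs f≗g = cong sumℚ (map-cong f≗g xs)

∑-cong-∈ : ∀ (xs : List X) {f g : X → ℚ} → (∀ {x} → x ∈ xs → f x ≡ g x) → ∑ xs f ≡ ∑ xs g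
∑-cong-∈ []       f≗g = refl
∑-cong-∈ (x ∷ xs) f≗g = cong₂ _+_ (f≗g (here refl)) (∑-cong-∈ xs (f≗g ∘ there))

∑-map : ∀ (h : X → Y) xs (f : Y → ℚ) → ∑ (map h xs) f ≡ ∑ xs (f ∘ h)
∑-map h xs f = cong sumℚ (sym (map-∘ xs))

∑-++ : ∀ (xs ys : List X) (f : X → ℚ) → ∑ (xs ++ ys) f ≡ ∑ xs f + ∑ ys f
∑-++ []       ys f = sym (+-identityˡ _)
∑-++ (x ∷ xs) ys f = trans (cong (f x +_) (∑-++ xs ys f)) (sym (+-assoc (f x) _ _))

∑-concatMap : ∀ (h : X → List Y) xs (f : Y → ℚ) → ∑ (concatMap h xs) f ≡ ∑ xs (λ x → ∑ (h x) f)
∑-concatMap h []       f = refl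
∑-concatMap h (x ∷ xs) f = trans (∑-++ (h x) _ f) (cong (∑ (h x) f +_) (∑-concatMap h xs f))

∑-0 : ∀ (xs : List X) {f : X → ℚ} → (∀ x → f x ≡ 0ℚ) → ∑ xs f ≡ 0ℚ
∑-0 []       f≗0 = refl
∑-0 (x ∷ xs) f≗0 = cong₂ _+_ (f≗0 x) (∑-0 xs f≗0)

∑-+ : ∀ (xs : List X) (f g : X → ℚ) → ∑ xs (λ x → f x + g x) ≡ ∑ xs f + ∑ xs g
∑-+ []       f g = refl
∑-+ (x ∷ xs) f g = trans (cong (f x + g x +_) (∑-+ xs f g))
  (solve 4 (λ a b c d → a :+ b :+ (c :+ d) := a :+ c :+ (b :+ d)) refl (f x) (g x) (∑ xs f) (∑ xs g))
  where open +-*-Solver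

∑-*ˡ : ∀ (xs : List X) c (f : X → ℚ) → ∑ xs (λ x → c * f x) ≡ c * ∑ xs f
∑-*ˡ []       c f = sym (*-zeroʳ c)
∑-*ˡ (x ∷ xs) c f = trans (cong (c * f x +_) (∑-*ˡ xs c f)) (sym (*-distribˡ-+ c _ _))

∑-*ʳ : ∀ (xs : List X) c (f : X → ℚ) → ∑ xs (λ x → f x * c) ≡ ∑ xs f * c
∑-*ʳ xs c f = trans (∑-cong xs (λ x → *-comm (f x) c)) (trans (∑-*ˡ xs c f) (*-comm c _))

∑-comm : ∀ (xs : List X) (ys : List Y) (f : X → Y → ℚ) →
  ∑ xs (λ x → ∑ ys (f x)) ≡ ∑ ys (λ y → ∑ xs (λ x → f x y))
∑-comm []       ys f = sym (∑-0 ys (λ _ → refl))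
∑-comm (x ∷ xs) ys f = trans (cong (∑ ys (f x) +_) (∑-comm xs ys f)) (sym (∑-+ ys _ _))

-- The character γ

ι : ℕ → ℚ
ι k = pos k ℚ./ 1

-- Rationals are stored in lowest terms, so neither side reduces for a variable `k`; the identity is
-- checked on unreduced fractions, where it is integer arithmetic.
ι-suc : ∀ k → ι (suc k) ≡ 1ℚ + ι k
ι-suc k = toℚᵘ-injective (begin
  ℚ.toℚᵘ (ι (suc k))             ≈⟨ toℚᵘ-fromℚᵘ (ℚᵘ.mkℚᵘ (pos (suc k)) 0) ⟩
  ℚᵘ.mkℚᵘ (pos (suc k)) 0            ≈⟨ ℚᵘ.*≡* (cong (ℤ._* pos 1) (cong (ℤ._+_ (pos 1)) (sym (ℤ.*-identityʳ (pos k))))) ⟩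
  ℚᵘ.1ℚᵘ ℚᵘ.+ ℚᵘ.mkℚᵘ (pos k) 0    ≈⟨ ℚᵘ.+-congʳ ℚᵘ.1ℚᵘ (toℚᵘ-fromℚᵘ (ℚᵘ.mkℚᵘ (pos k) 0)) ⟨
  ℚᵘ.1ℚᵘ ℚᵘ.+ ℚ.toℚᵘ (ι k)       ≈⟨ toℚᵘ-homo-+ 1ℚ (ι k) ⟨
  ℚ.toℚᵘ (1ℚ + ι k)              ∎)
  where open ℚᵘ.≃-Reasoning

suc*inv! : ∀ k → ι (suc k) * inv! (suc k) ≡ inv! k
suc*inv! k = scale k (k !) (suc k !) {{k ℕ.!≢0}} {{suc k ℕ.!≢0}} refl
  where
  open ℚᵘ.≃-Reasoning
  -- The factorials become arbitrary nonzero `m` and `n` tied by one equation, so that both can be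
  -- matched as successors.
  scale : ∀ k m n .{{_ : NonZero m}} .{{_ : NonZero n}} → n ≡ suc k ℕ.* m → ι (suc k) * (pos 1 ℚ./ n) ≡ pos 1 ℚ./ m
  scale k (suc m) (suc n) eq = toℚᵘ-injective (begin
    ℚ.toℚᵘ (ι (suc k) * (pos 1 ℚ./ suc n))
      ≈⟨ toℚᵘ-homo-* (ι (suc k)) (pos 1 ℚ./ suc n) ⟩
    ℚ.toℚᵘ (ι (suc k)) ℚᵘ.* ℚ.toℚᵘ (pos 1 ℚ./ suc n)
      ≈⟨ ℚᵘ.*-cong (toℚᵘ-fromℚᵘ (ℚᵘ.mkℚᵘ (pos (suc k)) 0)) (toℚᵘ-fromℚᵘ (ℚᵘ.mkℚᵘ (pos 1) n)) ⟩
    ℚᵘ.mkℚᵘ (pos (suc k)) 0 ℚᵘ.* ℚᵘ.mkℚᵘ (pos 1) n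
      ≈⟨ ℚᵘ.*≡* (cong pos (trans (cong (ℕ._* suc m) (ℕ.*-identityʳ (suc k))) (trans (sym eq) (sym (trans (ℕ.*-identityˡ _) (ℕ.*-identityˡ _)))))) ⟩
    ℚᵘ.mkℚᵘ (pos 1) m
      ≈⟨ toℚᵘ-fromℚᵘ (ℚᵘ.mkℚᵘ (pos 1) m) ⟨
    ℚ.toℚᵘ (pos 1 ℚ./ suc m) ∎)

-- This is (k + 1) / (k + 1)! = 1 / k! in the form in which `insert-equal` meets it: one new slot
-- plus `k` old ones, all of the same weight.
inv!-step : ∀ k c → inv! (suc k) * c + ι k * (inv! (suc k) * c) ≡ inv! k * c
inv!-step k c = begin
  inv! (suc k) * c + ι k * (inv! (suc k) * c)
    ≡⟨ solve 3 (λ i k c → i :* c :+ k :* (i :* c) := (con 1ℚ :+ k) :* i :* c) refl (inv! (suc k)) (ι k) c ⟩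
  (1ℚ + ι k) * inv! (suc k) * c
    ≡⟨ cong (λ z → z * inv! (suc k) * c) (ι-suc k) ⟨
  ι (suc k) * inv! (suc k) * c
    ≡⟨ cong (_* c) (suc*inv! k) ⟩
  inv! k * c ∎
  where
  open ≡-Reasoning
  open +-*-Solver

runsFrom : ℕ → ℕ → List ℕ → List ℕ
runsFrom y k []       = k ∷ []
runsFrom y k (z ∷ zs) = if y ==ℕ z then runsFrom y (suc k) zs else k ∷ runsFrom z 1 zs

-- The helper of runs is out of scope: the left-hand side of runsFrom-unique is that
-- helper, found by unification, which needs its arguments to be distinct variables;
-- hence the abstraction of y ∷ z ∷ zs, 2 and 3.
mutual
  runs≡runsFrom : ∀ x xs → runs (x ∷ xs) ≡ runsFrom x 1 xs
  runs≡runsFrom x []       = refl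
  runs≡runsFrom x (y ∷ []) = refl
  runs≡runsFrom x (y ∷ z ∷ zs) with y List.∷ z List.∷ zs | 2 | 3
  ... | w | k | l = cong₂ (if_then_else_ (x ==ℕ y))
    (cong₂ (if_then_else_ (x ==ℕ z)) (runsFrom-unique x w x l zs) (cong (k ∷_) (runsFrom-unique x w z 1 zs)))
    (cong (1 ∷_) (cong₂ (if_then_else_ (y ==ℕ z)) (runsFrom-unique x w y k zs) (cong (1 ∷_) (runsFrom-unique x w z 1 zs))))

  runsFrom-unique : ∀ x w y k zs → _ ≡ runsFrom y k zs
  runsFrom-unique x w y k []       = refl
  runsFrom-unique x w y k (z ∷ zs) = cong₂ (if_then_else_ (y ==ℕ z))
    (runsFrom-unique x w y (suc k) zs) (cong (k ∷_) (runsFrom-unique x w z 1 zs))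

-- The weight of k copies of y followed by zs.
γFrom : ℕ → ℕ → List ℕ → ℚ
γFrom y k zs = if weaklyIncreasing (y ∷ zs) then prodℚ (map inv! (runsFrom y k zs)) else 0ℚ

γ-∷ : ∀ y zs → γ (y ∷ zs) ≡ γFrom y 1 zs
γ-∷ y zs = cong (λ rs → if weaklyIncreasing (y ∷ zs) then prodℚ (map inv! rs) else 0ℚ) (runs≡runsFrom y zs)

γFrom-≈ : ∀ y k zs → γFrom y k (y ∷ zs) ≡ γFrom y (suc k) zs
γFrom-≈ y k zs rewrite dec-true (y ℕ.≤? y) ℕ.≤-refl | dec-true (y ℕ.≟ y) refl = refl

γFrom-< : ∀ {y z} k zs → y ℕ.< z → γFrom y k (z ∷ zs) ≡ inv! k * γFrom z 1 zs
γFrom-< {y} {z} k zs y<z rewrite dec-true (y ℕ.≤? z) (ℕ.<⇒≤ y<z) | dec-false (y ℕ.≟ z) (ℕ.<⇒≢ y<z)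
  with weaklyIncreasing (z ∷ zs)
... | true  = refl
... | false = sym (*-zeroʳ (inv! k))

γFrom-> : ∀ {y z} k zs → z ℕ.< y → γFrom y k (z ∷ zs) ≡ 0ℚ
γFrom-> {y} {z} k zs z<y rewrite dec-false (y ℕ.≤? z) (ℕ.<⇒≱ z<y) = refl

∑-insertions-∷ : ∀ (f : List X → ℚ) x y ys →
  ∑ (insertions x (y ∷ ys)) f ≡ f (x ∷ y ∷ ys) + ∑ (insertions x ys) (f ∘ (y ∷_))
∑-insertions-∷ f x y ys = cong (f (x ∷ y ∷ ys) +_) (∑-map (y ∷_) (insertions x ys) f)

-- Every insertion puts `x` somewhere behind the larger `y`, so no resulting list is weakly
-- increasing.
insert-small : ∀ {x y} k zs → x ℕ.< y → ∑ (insertions x zs) (γFrom y k) ≡ 0ℚ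
insert-small {x} {y} k [] x<y = trans (+-identityʳ _) (γFrom-> k [] x<y)
insert-small {x} {y} k (z ∷ zs) x<y = begin
  ∑ (insertions x (z ∷ zs)) (γFrom y k)
    ≡⟨ ∑-insertions-∷ (γFrom y k) x z zs ⟩
  γFrom y k (x ∷ z ∷ zs) + ∑ (insertions x zs) (γFrom y k ∘ (z ∷_))
    ≡⟨ cong₂ _+_ (γFrom-> k (z ∷ zs) x<y) tail ⟩
  0ℚ ∎
  where
  open ≡-Reasoning
  tail : ∑ (insertions x zs) (γFrom y k ∘ (z ∷_)) ≡ 0ℚ
  tail with ℕ.<-cmp y z
  ... | tri< y<z _ _ = trans (∑-cong (insertions x zs) (λ o → γFrom-< k o y<z))
    (trans (∑-*ˡ (insertions x zs) (inv! k) _)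
    (trans (cong (inv! k *_) (insert-small 1 zs (ℕ.<-trans x<y y<z))) (*-zeroʳ (inv! k))))
  ... | tri≈ _ refl _ = trans (∑-cong (insertions x zs) (γFrom-≈ y k)) (insert-small (suc k) zs x<y)
  ... | tri> _ _ z<y = ∑-0 (insertions x zs) (λ o → γFrom-> k o z<y)

-- The summand with `ι k` stands for the `k` slots in front of the `k` copies of `y` already read.
-- If `zs` begins with exactly m copies of `y`, there are k + m + 1 slots next to copies of `y`, all
-- giving the same list, and (k + m + 1) / (k + m + 1)! = 1 / (k + m)!. Slots behind a larger entry
-- contribute nothing.
insert-equal : ∀ y k zs → ∑ (insertions y zs) (γFrom y k) + ι k * γFrom y (suc k) zs ≡ γFrom y k zs
insert-equal y k [] = begin
  γFrom y k (y ∷ []) + 0ℚ + ι k * (inv! (suc k) * 1ℚ)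
    ≡⟨ cong (_+ ι k * (inv! (suc k) * 1ℚ)) (trans (+-identityʳ _) (γFrom-≈ y k [])) ⟩
  inv! (suc k) * 1ℚ + ι k * (inv! (suc k) * 1ℚ)
    ≡⟨ inv!-step k 1ℚ ⟩
  inv! k * 1ℚ ∎
  where open ≡-Reasoning
insert-equal y k (z ∷ zs) = trans
  (cong (_+ ι k * γFrom y (suc k) (z ∷ zs))
    (trans (∑-insertions-∷ (γFrom y k) y z zs) (cong (_+ rest) (γFrom-≈ y k (z ∷ zs)))))
  step
  where
  open ≡-Reasoning
  rest : ℚ
  rest = ∑ (insertions y zs) (γFrom y k ∘ (z ∷_))
  step : γFrom y (suc k) (z ∷ zs) + rest + ι k * γFrom y (suc k) (z ∷ zs) ≡ γFrom y k (z ∷ zs)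
  step with ℕ.<-cmp y z
  ... | tri< y<z _ _ = begin
    γFrom y (suc k) (z ∷ zs) + rest + ι k * γFrom y (suc k) (z ∷ zs)
      ≡⟨ cong₂ (λ a b → a + b + ι k * a) (γFrom-< (suc k) zs y<z)
           (trans (∑-cong (insertions y zs) (λ o → γFrom-< k o y<z))
           (trans (∑-*ˡ (insertions y zs) (inv! k) _)
           (trans (cong (inv! k *_) (insert-small 1 zs y<z)) (*-zeroʳ (inv! k))))) ⟩
    inv! (suc k) * γFrom z 1 zs + 0ℚ + ι k * (inv! (suc k) * γFrom z 1 zs)
      ≡⟨ cong (_+ ι k * (inv! (suc k) * γFrom z 1 zs)) (+-identityʳ (inv! (suc k) * γFrom z 1 zs)) ⟩
    inv! (suc k) * γFrom z 1 zs + ι k * (inv! (suc k) * γFrom z 1 zs)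
      ≡⟨ inv!-step k (γFrom z 1 zs) ⟩
    inv! k * γFrom z 1 zs
      ≡⟨ γFrom-< k zs y<z ⟨
    γFrom y k (z ∷ zs) ∎
  ... | tri≈ _ refl _ = begin
    γFrom y (suc k) (y ∷ zs) + rest + ι k * γFrom y (suc k) (y ∷ zs)
      ≡⟨ cong₂ (λ a b → a + b + ι k * a) (γFrom-≈ y (suc k) zs) (∑-cong (insertions y zs) (γFrom-≈ y k)) ⟩
    γFrom y (2 ℕ.+ k) zs + rest′ + ι k * γFrom y (2 ℕ.+ k) zs
      -- The front slot joins the `k` old ones, which gives the factor `ι (suc k)` that the
      -- induction hypothesis expects.
      ≡⟨ solve 3 (λ a b i → a :+ b :+ i :* a := b :+ (con 1ℚ :+ i) :* a) refl (γFrom y (2 ℕ.+ k) zs) rest′ (ι k) ⟩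
    rest′ + (1ℚ + ι k) * γFrom y (2 ℕ.+ k) zs
      ≡⟨ cong (λ i → rest′ + i * γFrom y (2 ℕ.+ k) zs) (ι-suc k) ⟨
    rest′ + ι (suc k) * γFrom y (2 ℕ.+ k) zs
      ≡⟨ insert-equal y (suc k) zs ⟩
    γFrom y (suc k) zs
      ≡⟨ γFrom-≈ y k zs ⟨
    γFrom y k (y ∷ zs) ∎
    where
    open +-*-Solver
    rest′ : ℚ
    rest′ = ∑ (insertions y zs) (γFrom y (suc k))
  ... | tri> _ _ z<y = begin
    γFrom y (suc k) (z ∷ zs) + rest + ι k * γFrom y (suc k) (z ∷ zs)
      ≡⟨ cong₂ (λ a b → a + b + ι k * a) (γFrom-> (suc k) zs z<y) (∑-0 (insertions y zs) (λ o → γFrom-> k o z<y)) ⟩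
    0ℚ + ι k * 0ℚ
      ≡⟨ cong (0ℚ +_) (*-zeroʳ (ι k)) ⟩
    0ℚ
      ≡⟨ γFrom-> k zs z<y ⟨
    γFrom y k (z ∷ zs) ∎

mutual
  -- Induction on `zs`. Once an entry `z` larger than `y` closes the run, the factor `inv! k` comes
  -- out, and what is left is an insertion around `z` with no known order between `x` and `z`; hence
  -- the mutual recursion with `insert-any`.
  insert-large : ∀ {x y} k zs → y ℕ.< x → ∑ (insertions x zs) (γFrom y k) ≡ γFrom y k zs
  insert-large k [] y<x = trans (+-identityʳ _) (γFrom-< k [] y<x)
  insert-large {x} {y} k (z ∷ zs) y<x = trans (∑-insertions-∷ (γFrom y k) x z zs) step
    where
    open ≡-Reasoning
    step : γFrom y k (x ∷ z ∷ zs) + ∑ (insertions x zs) (γFrom y k ∘ (z ∷_)) ≡ γFrom y k (z ∷ zs)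
    step with ℕ.<-cmp y z
    ... | tri< y<z _ _ = begin
      γFrom y k (x ∷ z ∷ zs) + ∑ (insertions x zs) (γFrom y k ∘ (z ∷_))
        ≡⟨ cong₂ _+_ (γFrom-< k (z ∷ zs) y<x)
             (trans (∑-cong (insertions x zs) (λ o → γFrom-< k o y<z)) (∑-*ˡ (insertions x zs) (inv! k) _)) ⟩
      inv! k * γFrom x 1 (z ∷ zs) + inv! k * ∑ (insertions x zs) (γFrom z 1)
        ≡⟨ *-distribˡ-+ (inv! k) _ _ ⟨
      inv! k * (γFrom x 1 (z ∷ zs) + ∑ (insertions x zs) (γFrom z 1))
        ≡⟨ cong (inv! k *_) (insert-any x z zs) ⟩
      inv! k * γFrom z 1 zs
        ≡⟨ γFrom-< k zs y<z ⟨
      γFrom y k (z ∷ zs) ∎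
    ... | tri≈ _ refl _ = begin
      γFrom y k (x ∷ y ∷ zs) + ∑ (insertions x zs) (γFrom y k ∘ (y ∷_))
        ≡⟨ cong₂ _+_ (γFrom-< k (y ∷ zs) y<x) (∑-cong (insertions x zs) (γFrom-≈ y k)) ⟩
      inv! k * γFrom x 1 (y ∷ zs) + ∑ (insertions x zs) (γFrom y (suc k))
        ≡⟨ cong₂ _+_ (trans (cong (inv! k *_) (γFrom-> 1 zs y<x)) (*-zeroʳ (inv! k))) (insert-large (suc k) zs y<x) ⟩
      0ℚ + γFrom y (suc k) zs
        ≡⟨ +-identityˡ _ ⟩
      γFrom y (suc k) zs
        ≡⟨ γFrom-≈ y k zs ⟨
      γFrom y k (y ∷ zs) ∎
    ... | tri> _ _ z<y = begin
      γFrom y k (x ∷ z ∷ zs) + ∑ (insertions x zs) (γFrom y k ∘ (z ∷_))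
        ≡⟨ cong₂ _+_ (γFrom-< k (z ∷ zs) y<x) (∑-0 (insertions x zs) (λ o → γFrom-> k o z<y)) ⟩
      inv! k * γFrom x 1 (z ∷ zs) + 0ℚ
        ≡⟨ cong (λ c → inv! k * c + 0ℚ) (γFrom-> 1 zs (ℕ.<-trans z<y y<x)) ⟩
      inv! k * 0ℚ + 0ℚ
        ≡⟨ cong (_+ 0ℚ) (*-zeroʳ (inv! k)) ⟩
      0ℚ
        ≡⟨ γFrom-> k zs z<y ⟨
      γFrom y k (z ∷ zs) ∎

  -- The slot before `z` is separated from those behind it. A smaller `x` fits only before `z`, a
  -- larger one only behind. For equal letters the slot before `z` is the one old slot counted by
  -- `ι 1` in `insert-equal`.
  insert-any : ∀ x z zs → γFrom x 1 (z ∷ zs) + ∑ (insertions x zs) (γFrom z 1) ≡ γFrom z 1 zs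
  insert-any x z zs with ℕ.<-cmp x z
  ... | tri< x<z _ _ = trans (cong₂ _+_ (γFrom-< 1 zs x<z) (insert-small 1 zs x<z))
    (trans (+-identityʳ _) (*-identityˡ _))
  ... | tri≈ _ refl _ = begin
    γFrom z 1 (z ∷ zs) + ∑ (insertions z zs) (γFrom z 1)
      ≡⟨ cong (_+ ∑ (insertions z zs) (γFrom z 1)) (γFrom-≈ z 1 zs) ⟩
    γFrom z 2 zs + ∑ (insertions z zs) (γFrom z 1)
      ≡⟨ +-comm (γFrom z 2 zs) (∑ (insertions z zs) (γFrom z 1)) ⟩
    ∑ (insertions z zs) (γFrom z 1) + γFrom z 2 zs
      ≡⟨ cong (∑ (insertions z zs) (γFrom z 1) +_) (*-identityˡ _) ⟨
    ∑ (insertions z zs) (γFrom z 1) + ι 1 * γFrom z 2 zs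
      ≡⟨ insert-equal z 1 zs ⟩
    γFrom z 1 zs ∎
    where open ≡-Reasoning
  ... | tri> _ _ z<x = trans (cong₂ _+_ (γFrom-> 1 zs z<x) (insert-large 1 zs z<x)) (+-identityˡ _)

-- γ is multiplicative on P_(x) · P_β, and γ (P_(x)) = 1.
∑-insertions-γ : ∀ x β → ∑ (insertions x β) γ ≡ γ β
∑-insertions-γ x []       = refl
∑-insertions-γ x (z ∷ zs) = begin
  ∑ (insertions x (z ∷ zs)) γ
    ≡⟨ ∑-insertions-∷ γ x z zs ⟩
  γ (x ∷ z ∷ zs) + ∑ (insertions x zs) (γ ∘ (z ∷_))
    ≡⟨ cong₂ _+_ (γ-∷ x (z ∷ zs)) (∑-cong (insertions x zs) (γ-∷ z)) ⟩
  γFrom x 1 (z ∷ zs) + ∑ (insertions x zs) (γFrom z 1)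
    ≡⟨ insert-any x z zs ⟩
  γFrom z 1 zs
    ≡⟨ γ-∷ z zs ⟨
  γ (z ∷ zs) ∎
  where open ≡-Reasoning

map-insertions : ∀ (f : X → Y) x xs → map (map f) (insertions x xs) ≡ insertions (f x) (map f xs)
map-insertions f x []       = refl
map-insertions f x (y ∷ ys) = cong ((f x ∷ f y ∷ map f ys) ∷_) (begin
  map (map f) (map (y ∷_) (insertions x ys))    ≡⟨ map-∘ (insertions x ys) ⟨
  map (λ o → f y ∷ map f o) (insertions x ys)   ≡⟨ map-∘ (insertions x ys) ⟩
  map (f y ∷_) (map (map f) (insertions x ys))  ≡⟨ cong (map (f y ∷_)) (map-insertions f x ys) ⟩
  map (f y ∷_) (insertions (f x) (map f ys))    ∎)
  where open ≡-Reasoning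

-- The sum over orderings is γ of the shuffle product of the one-letter elements P_(f x). Since
-- `perms` builds the orderings by inserting one letter at a time, `∑-insertions-γ` removes the
-- letters one by one.
∑-perms-γ : ∀ (f : X → ℕ) xs → ∑ (perms xs) (γ ∘ map f) ≡ 1ℚ
∑-perms-γ f []       = refl
∑-perms-γ f (x ∷ xs) = begin
  ∑ (perms (x ∷ xs)) (γ ∘ map f)
    ≡⟨ ∑-concatMap (insertions x) (perms xs) (γ ∘ map f) ⟩
  ∑ (perms xs) (λ o → ∑ (insertions x o) (γ ∘ map f))
    ≡⟨ ∑-cong (perms xs) (λ o → trans (sym (∑-map (map f) (insertions x o) γ))
         (trans (cong (λ l → ∑ l γ) (map-insertions f x o)) (∑-insertions-γ (f x) (map f o)))) ⟩
  ∑ (perms xs) (γ ∘ map f)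
    ≡⟨ ∑-perms-γ f xs ⟩
  1ℚ ∎
  where open ≡-Reasoning

-- The map θ

matchLengths : List (List ℕ) → List ℕ → Bool
matchLengths []       []      = true
matchLengths (p ∷ ps) (a ∷ α) = (length p ==ℕ a) ∧ matchLengths ps α
matchLengths _        _       = false

weight : List ℕ → List (List ℕ) → ℚ
weight α ps = if matchLengths ps α then prodℚ (map γ ps) else 0ℚ

-- matchLengths-top and matchLengths-unique identify the out-of-scope helper of
-- θ-coeff in the same way.
mutual
  θ-coeff≡∑ : ∀ β α → θ-coeff β α ≡ ∑ (deconcat (length α) β) (weight α)
  θ-coeff≡∑ β α = ∑-cong (deconcat (length α) β)
    (λ ps → cong (λ b → if b then prodℚ (map γ ps) else 0ℚ) (matchLengths-top β α ps))

  matchLengths-top : ∀ β α ps → _ ≡ matchLengths ps α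
  matchLengths-top β []      []       = refl
  matchLengths-top β []      (p ∷ ps) = refl
  matchLengths-top β (a ∷ α) []       = refl
  matchLengths-top β (a ∷ α) (p ∷ ps) with a List.∷ α
  ... | w = cong ((length p ==ℕ a) ∧_) (matchLengths-unique β w ps α)

  matchLengths-unique : ∀ β w ps α → _ ≡ matchLengths ps α
  matchLengths-unique β w []       []      = refl
  matchLengths-unique β w []       (a ∷ α) = refl
  matchLengths-unique β w (p ∷ ps) []      = refl
  matchLengths-unique β w (p ∷ ps) (a ∷ α) = cong ((length p ==ℕ a) ∧_) (matchLengths-unique β w ps α)

-- cut a G xs is G (take a xs) (drop a xs) if a ≤ length xs, and 0 otherwise.
cut : ℕ → (List X → List X → ℚ) → List X → ℚ
cut zero    G xs       = G [] xs
cut (suc a) G []       = 0ℚ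
cut (suc a) G (x ∷ xs) = cut a (λ p → G (x ∷ p)) xs

cut-cong : ∀ a {G H : List X → List X → ℚ} → (∀ p q → G p q ≡ H p q) → ∀ xs → cut a G xs ≡ cut a H xs
cut-cong zero    G≗H xs       = G≗H [] xs
cut-cong (suc a) G≗H []       = refl
cut-cong (suc a) G≗H (x ∷ xs) = cut-cong a (λ p → G≗H (x ∷ p)) xs

cut-+ : ∀ a (G H : List X → List X → ℚ) xs → cut a (λ p q → G p q + H p q) xs ≡ cut a G xs + cut a H xs
cut-+ zero    G H xs       = refl
cut-+ (suc a) G H []       = refl
cut-+ (suc a) G H (x ∷ xs) = cut-+ a (G ∘ (x ∷_)) (H ∘ (x ∷_)) xs

-- The prefixes of `β` have pairwise distinct lengths, so at most one cut position passes the length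
-- test, and none does if `β` is shorter than `a`.
∑-cut : ∀ a (H : List X → List X → ℚ) β →
  ∑ (upTo (suc (length β))) (λ p → if length (take p β) ==ℕ a then H (take p β) (drop p β) else 0ℚ) ≡ cut a H β
∑-cut zero    H []       = +-identityʳ _
∑-cut (suc a) H []       = refl
∑-cut a       H (y ∷ ys) = trans
  (cong (s 0 +_) (trans (cong (λ l → ∑ l s) (sym (map-applyUpTo id suc (suc (length ys))))) (∑-map suc (upTo (suc (length ys))) s)))
  (step a)
  where
  t : ℕ → ℕ → ℚ
  t a p = if length (take p (y ∷ ys)) ==ℕ a then H (take p (y ∷ ys)) (drop p (y ∷ ys)) else 0ℚ
  s : ℕ → ℚ
  s = t a
  step : ∀ a → t a 0 + ∑ (upTo (suc (length ys))) (t a ∘ suc) ≡ cut a H (y ∷ ys)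
  step zero    = trans (cong (t 0 0 +_) (∑-0 (upTo (suc (length ys))) (λ _ → refl))) (+-identityʳ _)
  step (suc a) = trans (+-identityˡ _) (∑-cut a (λ p → H (y ∷ p)) ys)

-- The length test fixes the first piece of a deconcatenation as the first `a` letters. This turns
-- the sum over deconcatenations into a recursion on the composition.
θ-coeff-∷ : ∀ β a α → θ-coeff β (a ∷ α) ≡ cut a (λ p q → γ p * θ-coeff q α) β
θ-coeff-∷ β a α = begin
  θ-coeff β (a ∷ α)
    ≡⟨ θ-coeff≡∑ β (a ∷ α) ⟩
  ∑ (deconcat (suc (length α)) β) (weight (a ∷ α))
    ≡⟨ ∑-concatMap pieces (upTo (suc (length β))) (weight (a ∷ α)) ⟩
  ∑ (upTo (suc (length β))) (λ p → ∑ (pieces p) (weight (a ∷ α)))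
    ≡⟨ ∑-cong (upTo (suc (length β))) (λ p → trans
         (∑-map (take p β ∷_) (deconcat (length α) (drop p β)) (weight (a ∷ α)))
         (first-piece (take p β) (drop p β))) ⟩
  ∑ (upTo (suc (length β))) (λ p → if length (take p β) ==ℕ a then γ (take p β) * θ-coeff (drop p β) α else 0ℚ)
    ≡⟨ ∑-cut a (λ p q → γ p * θ-coeff q α) β ⟩
  cut a (λ p q → γ p * θ-coeff q α) β ∎
  where
  open ≡-Reasoning
  pieces : ℕ → List (List (List ℕ))
  pieces p = map (take p β ∷_) (deconcat (length α) (drop p β))
  first-piece : ∀ p q → ∑ (deconcat (length α) q) (weight (a ∷ α) ∘ (p ∷_)) ≡
    (if length p ==ℕ a then γ p * θ-coeff q α else 0ℚ)
  first-piece p q with length p ==ℕ a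
  ... | false = ∑-0 (deconcat (length α) q) (λ _ → refl)
  ... | true  = begin
    ∑ (deconcat (length α) q) (λ ps → if matchLengths ps α then γ p * prodℚ (map γ ps) else 0ℚ)
      ≡⟨ ∑-cong (deconcat (length α) q) (λ ps → factor ps (matchLengths ps α)) ⟩
    ∑ (deconcat (length α) q) (λ ps → γ p * weight α ps)
      ≡⟨ ∑-*ˡ (deconcat (length α) q) (γ p) (weight α) ⟩
    γ p * ∑ (deconcat (length α) q) (weight α)
      ≡⟨ cong (γ p *_) (θ-coeff≡∑ q α) ⟨
    γ p * θ-coeff q α ∎
    where
    factor : ∀ ps b → (if b then γ p * prodℚ (map γ ps) else 0ℚ) ≡ γ p * (if b then prodℚ (map γ ps) else 0ℚ)
    factor ps true  = refl
    factor ps false = sym (*-zeroʳ (γ p))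

-- The letter `x` lands either among the first `a + 1` entries, which then take only `a` entries
-- from `o`, or behind them. The two cases account for each slot once.
∑-insertions-cut : ∀ a (G : List X → List X → ℚ) x o →
  ∑ (insertions x o) (cut (suc a) G) ≡
  cut a (λ p q → ∑ (insertions x p) (λ p′ → G p′ q)) o + cut (suc a) (λ p q → ∑ (insertions x q) (G p)) o
∑-insertions-cut zero    G x []       = sym (+-identityʳ _)
∑-insertions-cut zero    G x (y ∷ ys) = trans (∑-insertions-∷ (cut 1 G) x y ys)
  (cong (_+ ∑ (insertions x ys) (G (y ∷ []))) (sym (+-identityʳ (G (x ∷ []) (y ∷ ys)))))
∑-insertions-cut (suc a) G x []       = refl
∑-insertions-cut (suc a) G x (y ∷ ys) = begin
  ∑ (insertions x (y ∷ ys)) (cut (2 ℕ.+ a) G)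
    ≡⟨ ∑-insertions-∷ (cut (2 ℕ.+ a) G) x y ys ⟩
  cut a G₀ ys + ∑ (insertions x ys) (cut (suc a) (G ∘ (y ∷_)))
    ≡⟨ cong (cut a G₀ ys +_) (∑-insertions-cut a (G ∘ (y ∷_)) x ys) ⟩
  cut a G₀ ys + (cut a G₁ ys + R)
    ≡⟨ +-assoc (cut a G₀ ys) (cut a G₁ ys) R ⟨
  cut a G₀ ys + cut a G₁ ys + R
    ≡⟨ cong (_+ R) (cut-+ a G₀ G₁ ys) ⟨
  cut a (λ p q → G₀ p q + G₁ p q) ys + R
    ≡⟨ cong (_+ R) (cut-cong a (λ p q → ∑-insertions-∷ (λ p′ → G p′ q) x y p) ys) ⟨
  cut a (λ p q → ∑ (insertions x (y ∷ p)) (λ p′ → G p′ q)) ys + R ∎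
  where
  open ≡-Reasoning
  G₀ G₁ : List _ → List _ → ℚ
  G₀ p q = G (x ∷ y ∷ p) q
  G₁ p q = ∑ (insertions x p) (λ p′ → G (y ∷ p′) q)
  R : ℚ
  R = cut (suc a) (λ p q → ∑ (insertions x q) (G (y ∷ p))) ys

-- Splitting the orderings of a list.

-- The sum of F p q over all ways to split xs into a sublist p of length a and its complement q.
splitSum : ℕ → (List X → List X → ℚ) → List X → ℚ
splitSum zero    F xs       = F [] xs
splitSum (suc a) F []       = 0ℚ
splitSum (suc a) F (x ∷ xs) = splitSum a (λ p → F (x ∷ p)) xs + splitSum (suc a) (λ p q → F p (x ∷ q)) xs

splitSum-cong : ∀ a {F G : List X → List X → ℚ} → (∀ p q → F p q ≡ G p q) → ∀ xs → splitSum a F xs ≡ splitSum a G xs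
splitSum-cong zero    F≗G xs       = F≗G [] xs
splitSum-cong (suc a) F≗G []       = refl
splitSum-cong (suc a) F≗G (x ∷ xs) = cong₂ _+_
  (splitSum-cong a (λ p → F≗G (x ∷ p)) xs) (splitSum-cong (suc a) (λ p q → F≗G p (x ∷ q)) xs)

splitSum-map : ∀ a (h : X → Y) (F : List Y → List Y → ℚ) xs →
  splitSum a F (map h xs) ≡ splitSum a (λ p q → F (map h p) (map h q)) xs
splitSum-map zero    h F xs       = refl
splitSum-map (suc a) h F []       = refl
splitSum-map (suc a) h F (x ∷ xs) = cong₂ _+_ (splitSum-map a h _ xs) (splitSum-map (suc a) h _ xs)

∑∑ : (List X → List X → ℚ) → List X → List X → ℚ
∑∑ G xs ys = ∑ (perms xs) (λ p → ∑ (perms ys) (G p))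

-- To order `xs` and cut after `a` entries is to choose which entries come first and then order both
-- parts independently. In the induction, `∑-insertions-cut` decides which part receives the head.
∑-perms-cut : ∀ a (G : List X → List X → ℚ) xs → ∑ (perms xs) (cut a G) ≡ splitSum a (∑∑ G) xs
∑-perms-cut zero    G xs       = sym (+-identityʳ _)
∑-perms-cut (suc a) G []       = refl
∑-perms-cut (suc a) G (x ∷ xs) = begin
  ∑ (perms (x ∷ xs)) (cut (suc a) G)
    ≡⟨ ∑-concatMap (insertions x) (perms xs) (cut (suc a) G) ⟩
  ∑ (perms xs) (λ o → ∑ (insertions x o) (cut (suc a) G))
    ≡⟨ ∑-cong (perms xs) (∑-insertions-cut a G x) ⟩
  ∑ (perms xs) (λ o → cut a Gˡ o + cut (suc a) Gʳ o)
    ≡⟨ ∑-+ (perms xs) (cut a Gˡ) (cut (suc a) Gʳ) ⟩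
  ∑ (perms xs) (cut a Gˡ) + ∑ (perms xs) (cut (suc a) Gʳ)
    ≡⟨ cong₂ _+_ (∑-perms-cut a Gˡ xs) (∑-perms-cut (suc a) Gʳ xs) ⟩
  splitSum a (∑∑ Gˡ) xs + splitSum (suc a) (∑∑ Gʳ) xs
    ≡⟨ cong₂ _+_ (splitSum-cong a left xs) (splitSum-cong (suc a) right xs) ⟩
  splitSum (suc a) (∑∑ G) (x ∷ xs) ∎
  where
  open ≡-Reasoning
  Gˡ Gʳ : List _ → List _ → ℚ
  Gˡ p q = ∑ (insertions x p) (λ p′ → G p′ q)
  Gʳ p q = ∑ (insertions x q) (G p)
  left : ∀ p q → ∑∑ Gˡ p q ≡ ∑∑ G (x ∷ p) q
  left p q = sym (trans (∑-concatMap (insertions x) (perms p) (λ p′ → ∑ (perms q) (G p′)))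
    (∑-cong (perms p) (λ o → ∑-comm (insertions x o) (perms q) G)))
  right : ∀ p q → ∑∑ Gʳ p q ≡ ∑∑ G p (x ∷ q)
  right p q = ∑-cong (perms p) (λ o → sym (∑-concatMap (insertions x) (perms q) (G o)))

-- Subsets, their elements and the blocks of a flag.

elements : Subset n → List (Fin n)
elements []          = []
elements (true  ∷ A) = zero ∷ map suc (elements A)
elements (false ∷ A) = map suc (elements A)

elements-∁⊥ : ∀ n → elements (∁ (⊥ {n})) ≡ allFin n
elements-∁⊥ zero    = refl
elements-∁⊥ (suc n) = cong (zero ∷_) (trans (cong (map suc) (elements-∁⊥ n)) (map-tabulate id suc))

∑-filter : ∀ {P : X → Set} (P? : Decidable P) xs (f : X → ℚ) →
  ∑ (filter P? xs) f ≡ ∑ xs (λ x → if does (P? x) then f x else 0ℚ)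
∑-filter P? []       f = refl
∑-filter P? (x ∷ xs) f with does (P? x)
... | true  = cong (f x +_) (∑-filter P? xs f)
... | false = trans (∑-filter P? xs f) (sym (+-identityˡ _))

-- These are the choices that one step of `flags` ranges over.
blocks : Subset n → ℕ → List (Subset n)
blocks {n} A a = filter (λ B → ∣ B ∣ ℕ.≟ a) (filter (λ B → ≡-dec Bool._≟_ (A ∩ B) ⊥) (allSubsets n))

-- The two filters of `blocks` become zero coefficients, so that the sum runs over all subsets and
-- can be split by membership of the first element.
restrict : Subset n → ℕ → (Subset n → ℚ) → Subset n → ℚ
restrict A a f B = if (A ∩ B) ==S ⊥ then (if ∣ B ∣ ==ℕ a then f B else 0ℚ) else 0ℚ

∑-blocks : ∀ (A : Subset n) a f → ∑ (blocks A a) f ≡ ∑ (allSubsets n) (restrict A a f)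
∑-blocks {n} A a f = trans (∑-filter (λ B → ∣ B ∣ ℕ.≟ a) (filter disjoint? (allSubsets n)) f)
  (∑-filter disjoint? (allSubsets n) (λ B → if ∣ B ∣ ==ℕ a then f B else 0ℚ))
  where
  disjoint? : Decidable (λ B → A ∩ B ≡ ⊥)
  disjoint? B = ≡-dec Bool._≟_ (A ∩ B) ⊥

∑-allSubsets-suc : ∀ n (f : Subset (suc n) → ℚ) →
  ∑ (allSubsets (suc n)) f ≡ ∑ (allSubsets n) (f ∘ (true ∷_)) + ∑ (allSubsets n) (f ∘ (false ∷_))
∑-allSubsets-suc n f = trans (∑-++ (map (true ∷_) (allSubsets n)) (map (false ∷_) (allSubsets n)) f)
  (cong₂ _+_ (∑-map (true ∷_) (allSubsets n) f) (∑-map (false ∷_) (allSubsets n) f))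

-- Both sides decide element by element: an element of `A` enters neither list, and any other goes
-- either to the block or to what remains, as in the two summands of `splitSum`.
restrict-split : ∀ (A : Subset n) a F →
  ∑ (allSubsets n) (restrict A a (λ B → F (elements B) (elements (∁ (A ∪ B))))) ≡ splitSum a F (elements (∁ A))
restrict-split [] zero    F = +-identityʳ _
restrict-split [] (suc a) F = refl
restrict-split {suc n} (true ∷ A) a F = begin
  ∑ (allSubsets (suc n)) f
    ≡⟨ ∑-allSubsets-suc n f ⟩
  ∑ (allSubsets n) (f ∘ (true ∷_)) + ∑ (allSubsets n) (f ∘ (false ∷_))
    -- A block containing `zero` would meet `A`, so those terms vanish.
    ≡⟨ cong₂ _+_ (∑-0 (allSubsets n) (λ _ → refl)) (restrict-split A a (λ p q → F (map suc p) (map suc q))) ⟩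
  0ℚ + splitSum a (λ p q → F (map suc p) (map suc q)) (elements (∁ A))
    ≡⟨ +-identityˡ _ ⟩
  splitSum a (λ p q → F (map suc p) (map suc q)) (elements (∁ A))
    ≡⟨ splitSum-map a suc F (elements (∁ A)) ⟨
  splitSum a F (map suc (elements (∁ A))) ∎
  where
  open ≡-Reasoning
  f : Subset (suc n) → ℚ
  f = restrict (true ∷ A) a (λ B → F (elements B) (elements (∁ ((true ∷ A) ∪ B))))
restrict-split {suc n} (false ∷ A) zero F = begin
  ∑ (allSubsets (suc n)) f
    ≡⟨ ∑-allSubsets-suc n f ⟩
  ∑ (allSubsets n) (f ∘ (true ∷_)) + ∑ (allSubsets n) (f ∘ (false ∷_))
    ≡⟨ cong₂ _+_ (∑-0 (allSubsets n) nonempty) (restrict-split A 0 (λ p q → F (map suc p) (zero ∷ map suc q))) ⟩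
  0ℚ + F [] (zero ∷ map suc (elements (∁ A)))
    ≡⟨ +-identityˡ _ ⟩
  F [] (zero ∷ map suc (elements (∁ A))) ∎
  where
  open ≡-Reasoning
  f : Subset (suc n) → ℚ
  f = restrict (false ∷ A) 0 (λ B → F (elements B) (elements (∁ ((false ∷ A) ∪ B))))
  -- A block containing `zero` fails the size test, the required size being 0.
  nonempty : ∀ B → f (true ∷ B) ≡ 0ℚ
  nonempty B with (A ∩ B) ==S ⊥
  ... | true  = refl
  ... | false = refl
restrict-split {suc n} (false ∷ A) (suc a) F = begin
  ∑ (allSubsets (suc n)) f
    ≡⟨ ∑-allSubsets-suc n f ⟩
  ∑ (allSubsets n) (f ∘ (true ∷_)) + ∑ (allSubsets n) (f ∘ (false ∷_))
    ≡⟨ cong₂ _+_ (restrict-split A a (λ p q → F (zero ∷ map suc p) (map suc q)))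
                 (restrict-split A (suc a) (λ p q → F (map suc p) (zero ∷ map suc q))) ⟩
  splitSum a (λ p q → F (zero ∷ map suc p) (map suc q)) (elements (∁ A)) +
  splitSum (suc a) (λ p q → F (map suc p) (zero ∷ map suc q)) (elements (∁ A))
    ≡⟨ cong₂ _+_ (splitSum-map a suc (F ∘ (zero ∷_)) (elements (∁ A)))
                 (splitSum-map (suc a) suc (λ p q → F p (zero ∷ q)) (elements (∁ A))) ⟨
  splitSum (suc a) F (zero ∷ map suc (elements (∁ A))) ∎
  where
  open ≡-Reasoning
  f : Subset (suc n) → ℚ
  f = restrict (false ∷ A) (suc a) (λ B → F (elements B) (elements (∁ ((false ∷ A) ∪ B))))

∑-blocks-split : ∀ (A : Subset n) a F →
  ∑ (blocks A a) (λ B → F (elements B) (elements (∁ (A ∪ B)))) ≡ splitSum a F (elements (∁ A))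
∑-blocks-split A a F = trans (∑-blocks A a _) (restrict-split A a F)

-- Orderings of a subset.

insertions-↭ : ∀ {x : X} xs {o} → o ∈ insertions x xs → o ↭ x ∷ xs
insertions-↭ []       (here refl) = ↭-refl
insertions-↭ (y ∷ ys) (here refl) = ↭-refl
insertions-↭ (y ∷ ys) (there o∈) with ∈-map⁻ (y ∷_) o∈
... | o′ , o′∈ , refl = ↭-trans (prep y (insertions-↭ ys o′∈)) (swap y _ ↭-refl)

perms-↭ : ∀ (xs : List X) {o} → o ∈ perms xs → o ↭ xs
perms-↭ []       (here refl) = ↭-refl
perms-↭ (x ∷ xs) o∈ = go (perms xs) (perms-↭ xs) (∈-concatMap⁻ (insertions x) {xs = perms xs} o∈)
  where
  go : ∀ {o} oss → (∀ {o} → o ∈ oss → o ↭ xs) → Any (λ o′ → o ∈ insertions x o′) oss → o ↭ x ∷ xs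
  go (o′ ∷ oss) h (here o∈)  = ↭-trans (insertions-↭ o′ o∈) (prep x (h (here refl)))
  go (o′ ∷ oss) h (there o∈) = go oss (h ∘ there) o∈

Unique-resp-⊑ : {xs ys : List X} → xs ⊑ ys → Unique ys → Unique xs
Unique-resp-⊑ []            []       = []
Unique-resp-⊑ (y ∷ʳ τ)      (_ ∷ u)  = Unique-resp-⊑ τ u
Unique-resp-⊑ (refl ∷ τ)    (x∉ ∷ u) = All-resp-⊆ τ x∉ ∷ Unique-resp-⊑ τ u

fromList : List (Fin n) → Subset n
fromList []       = ⊥
fromList (x ∷ xs) = ⁅ x ⁆ ∪ fromList xs

∈-fromList⁺ : ∀ {x} {xs : List (Fin n)} → x ∈ xs → x ∈ˢ fromList xs
∈-fromList⁺ (here refl) = x∈p∪q⁺ (inj₁ (x∈⁅x⁆ _))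
∈-fromList⁺ (there x∈)  = x∈p∪q⁺ (inj₂ (∈-fromList⁺ x∈))

∈-fromList⁻ : ∀ {x} (xs : List (Fin n)) → x ∈ˢ fromList xs → x ∈ xs
∈-fromList⁻ []       x∈ = contradiction x∈ ∉⊥
∈-fromList⁻ (y ∷ ys) x∈ = [ here ∘ x∈⁅y⁆⇒x≡y y , there ∘ ∈-fromList⁻ ys ]′ (x∈p∪q⁻ ⁅ y ⁆ (fromList ys) x∈)

∈-elements⁺ : ∀ {x} {B : Subset n} → x ∈ˢ B → x ∈ elements B
∈-elements⁺ here                    = here refl
∈-elements⁺ {B = true  ∷ B} (there x∈) = there (∈-map⁺ suc (∈-elements⁺ x∈))
∈-elements⁺ {B = false ∷ B} (there x∈) = ∈-map⁺ suc (∈-elements⁺ x∈)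

∈-elements⁻ : ∀ {x} (B : Subset n) → x ∈ elements B → x ∈ˢ B
∈-elements⁻ (true ∷ B)  (here refl) = here
∈-elements⁻ (true ∷ B)  (there x∈) with ∈-map⁻ suc x∈
... | _ , y∈ , refl = there (∈-elements⁻ B y∈)
∈-elements⁻ (false ∷ B) x∈ with ∈-map⁻ suc x∈
... | _ , y∈ , refl = there (∈-elements⁻ B y∈)

elements-unique : ∀ (B : Subset n) → Unique (elements B)
elements-unique []          = []
elements-unique (true ∷ B)  = All.map⁺ (All.universal (λ _ ()) (elements B)) ∷ Unique.map⁺ suc-injective (elements-unique B)
elements-unique (false ∷ B) = Unique.map⁺ suc-injective (elements-unique B)

module _ (B : Subset n) {o} (o∈ : o ∈ perms (elements B)) where

  ordering-unique : Unique o
  ordering-unique = Unique-resp-↭ (setoid _) (↭⇒↭ₛ (↭-sym (perms-↭ (elements B) o∈))) (elements-unique B)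

  fromList-ordering : fromList o ≡ B
  fromList-ordering = ⊆-antisym
    (λ x∈ → ∈-elements⁻ B (∈-resp-↭ (perms-↭ (elements B) o∈) (∈-fromList⁻ o x∈)))
    (λ x∈ → ∈-fromList⁺ (∈-resp-↭ (↭-sym (perms-↭ (elements B) o∈)) (∈-elements⁺ x∈)))

-- Characteristic functions and counting.

χ : Subset n → Fin n → ℕ
χ C x = if Vec.lookup C x then 1 else 0

∣⁅x⁆∪S∩C∣ : ∀ {x} (S C : Subset n) → x ∉ˢ S → ∣ (⁅ x ⁆ ∪ S) ∩ C ∣ ≡ χ C x ℕ.+ ∣ S ∩ C ∣
∣⁅x⁆∪S∩C∣ {x = zero} (true ∷ S)  (c ∷ C) x∉ = contradiction here x∉
∣⁅x⁆∪S∩C∣ {x = zero} (false ∷ S) (true ∷ C) x∉ = cong (λ S → suc ∣ S ∩ C ∣) (∪-identityˡ S)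
∣⁅x⁆∪S∩C∣ {x = zero} (false ∷ S) (false ∷ C) x∉ = cong (λ S → ∣ S ∩ C ∣) (∪-identityˡ S)
∣⁅x⁆∪S∩C∣ {x = suc x} (true ∷ S) (true ∷ C) x∉ = trans (cong suc (∣⁅x⁆∪S∩C∣ S C (x∉ ∘ there))) (sym (ℕ.+-suc (χ C x) _))
∣⁅x⁆∪S∩C∣ {x = suc x} (true ∷ S) (false ∷ C) x∉ = ∣⁅x⁆∪S∩C∣ S C (x∉ ∘ there)
∣⁅x⁆∪S∩C∣ {x = suc x} (false ∷ S) (c ∷ C) x∉ = ∣⁅x⁆∪S∩C∣ S C (x∉ ∘ there)

∣⊥∩C∣ : ∀ (C : Subset n) → ∣ ⊥ ∩ C ∣ ≡ 0
∣⊥∩C∣ []      = refl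
∣⊥∩C∣ (_ ∷ C) = ∣⊥∩C∣ C

∣fromList∩C∣ : ∀ {s : List (Fin n)} (C : Subset n) → Unique s → ∣ fromList s ∩ C ∣ ≡ sum (map (χ C) s)
∣fromList∩C∣ C [] = ∣⊥∩C∣ C
∣fromList∩C∣ {s = x ∷ s} C (x∉ ∷ u) = trans
  (∣⁅x⁆∪S∩C∣ (fromList s) C (λ x∈ → All.lookup x∉ (∈-fromList⁻ s x∈) refl))
  (cong (χ C x ℕ.+_) (∣fromList∩C∣ C u))

lookup-∉ : ∀ {x} (C : Subset n) → x ∉ˢ C → Vec.lookup C x ≡ false
lookup-∉ {x = x} C x∉ with Vec.lookup C x in eq
... | true  = contradiction (lookup⇒[]= x C eq) x∉
... | false = refl

χ-⁅x⁆∪ : ∀ x (C : Subset n) → χ (⁅ x ⁆ ∪ C) x ≡ 1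
χ-⁅x⁆∪ x C = cong (if_then 1 else 0) (trans (lookup-zipWith _∨_ x ⁅ x ⁆ C) (cong (_∨ Vec.lookup C x) ([]=⇒lookup (x∈⁅x⁆ x))))

χ-⁅y⁆∪ : ∀ {x y} (C : Subset n) → y ≢ x → χ (⁅ y ⁆ ∪ C) x ≡ χ C x
χ-⁅y⁆∪ {x = x} {y} C y≢x = cong (if_then 1 else 0) (trans (lookup-zipWith _∨_ x ⁅ y ⁆ C)
  (cong (_∨ Vec.lookup C x) (lookup-∉ ⁅ y ⁆ (x≢y⇒x∉⁅y⁆ (y≢x ∘ sym)))))

∈-allSubsets : ∀ (S : Subset n) → S ∈ allSubsets n
∈-allSubsets []          = here refl
∈-allSubsets (true ∷ S)  = ∈-++⁺ˡ (∈-map⁺ (true ∷_) (∈-allSubsets S))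
∈-allSubsets (false ∷ S) = ∈-++⁺ʳ (map (true ∷_) (allSubsets _)) (∈-map⁺ (false ∷_) (∈-allSubsets S))

elements-∁≡[] : ∀ (A : Subset n) → elements (∁ A) ≡ [] → A ≡ ⊤
elements-∁≡[] []          _ = refl
elements-∁≡[] (true ∷ A)  e with elements (∁ A) in eq
... | [] = cong (true ∷_) (elements-∁≡[] A eq)

elements-∁⊤ : ∀ m → elements (∁ (⊤ {m})) ≡ []
elements-∁⊤ zero    = refl
elements-∁⊤ (suc m) = cong (map suc) (elements-∁⊤ m)

-- Weakly increasing lists.

weaklyIncreasing-tail : ∀ x xs → T (weaklyIncreasing (x ∷ xs)) → T (weaklyIncreasing xs)
weaklyIncreasing-tail x []       _ = _
weaklyIncreasing-tail x (y ∷ xs) w = proj₂ (Equivalence.to (T-∧ {does (x ℕ.≤? y)}) w)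

weaklyIncreasing-head : ∀ x xs → T (weaklyIncreasing (x ∷ xs)) → All (x ≤_) xs
weaklyIncreasing-head x []       _ = []
weaklyIncreasing-head x (y ∷ xs) w with Equivalence.to (T-∧ {does (x ℕ.≤? y)}) w
... | x≤y , w′ = ℕ.≤ᵇ⇒≤ x y x≤y ∷ All.map (ℕ.≤-trans (ℕ.≤ᵇ⇒≤ x y x≤y)) (weaklyIncreasing-head y xs w′)

length≤sum : ∀ (c : X → ℕ) {xs} → All (λ x → 1 ≤ c x) xs → length xs ≤ sum (map c xs)
length≤sum c []       = ℕ.z≤n
length≤sum c (p ∷ ps) = ℕ.+-mono-≤ p (length≤sum c ps)

-- Matroids

module _ {n} (M : Matroid n) where
  open Matroid M

  increments : Subset n → List (Fin n) → List ℕ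
  increments = rankIncrements rk

  rk-∪⊥ : ∀ A → rk (A ∪ ⊥) ≡ rk A
  rk-∪⊥ A = cong rk (∪-identityʳ A)

  rk-∪-gain : ∀ A S → rk A ℕ.+ (rk (A ∪ S) ∸ rk A) ≡ rk (A ∪ S)
  rk-∪-gain A S = ℕ.m+[n∸m]≡n (rk-mono (p⊆p∪q S))

  rk-∪⁅x⁆ : ∀ A x → rk (A ∪ ⁅ x ⁆) ≤ rk A ℕ.+ 1
  rk-∪⁅x⁆ A x = ℕ.≤-trans (ℕ.m≤m+n _ (rk (A ∩ ⁅ x ⁆))) (ℕ.≤-trans (rk-sub A ⁅ x ⁆) (ℕ.+-monoʳ-≤ (rk A) (rk-pt x)))

  rk-∪-fromList : ∀ A s → rk (A ∪ fromList s) ≤ rk A ℕ.+ length s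
  rk-∪-fromList A []      = ℕ.≤-reflexive (trans (rk-∪⊥ A) (sym (ℕ.+-identityʳ _)))
  rk-∪-fromList A (x ∷ s) = begin
    rk (A ∪ (⁅ x ⁆ ∪ fromList s))   ≡⟨ cong rk (∪-assoc A ⁅ x ⁆ (fromList s)) ⟨
    rk ((A ∪ ⁅ x ⁆) ∪ fromList s)   ≤⟨ rk-∪-fromList (A ∪ ⁅ x ⁆) s ⟩
    rk (A ∪ ⁅ x ⁆) ℕ.+ length s     ≤⟨ ℕ.+-monoˡ-≤ (length s) (rk-∪⁅x⁆ A x) ⟩
    rk A ℕ.+ 1 ℕ.+ length s         ≡⟨ ℕ.+-assoc (rk A) 1 (length s) ⟩
    rk A ℕ.+ suc (length s)         ∎
    where open ℕ.≤-Reasoning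

  -- Submodularity for `A ∪ S` and `A ∪ R`, whose union contains `(A ∪ R) ∪ S` and whose
  -- intersection contains `A`. It is used as diminishing gain: `S` adds at most as much rank over
  -- `A ∪ R` as over `A`.
  rk-submodular : ∀ A S R → rk ((A ∪ R) ∪ S) ℕ.+ rk A ≤ rk (A ∪ S) ℕ.+ rk (A ∪ R)
  rk-submodular A S R = ℕ.≤-trans
    (ℕ.+-mono-≤
      (rk-mono (λ x∈ → [ q⊆p∪q (A ∪ S) (A ∪ R) , p⊆p∪q (A ∪ R) ∘ q⊆p∪q A S ]′ (x∈p∪q⁻ (A ∪ R) S x∈)))
      (rk-mono (λ x∈ → x∈p∩q⁺ (p⊆p∪q S x∈ , p⊆p∪q R x∈))))
    (rk-sub (A ∪ S) (A ∪ R))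

  -- Additivity of the rank over `A` is phrased for lists, so that it can be followed along the
  -- sublists of an ordering.
  rank-sum : Subset n → (Fin n → ℕ) → List (Fin n) → Set
  rank-sum A c s = rk (A ∪ fromList s) ≡ rk A ℕ.+ sum (map c s)

  -- The one-element sublist gives the first increment; the sublists starting with `x` give the
  -- hypothesis over the base `A ∪ ⁅ x ⁆`.
  rank-sums⇒increments : ∀ A o c → (∀ {s} → s ⊑ o → rank-sum A c s) → increments A o ≡ map c o
  rank-sums⇒increments A []      c h = refl
  rank-sums⇒increments A (x ∷ o) c h = cong₂ _∷_
    (trans (cong (_∸ rk A) gain) (ℕ.m+n∸m≡n (rk A) (c x)))
    (rank-sums⇒increments (A ∪ ⁅ x ⁆) o c (λ {s} s⊑o → begin
      rk ((A ∪ ⁅ x ⁆) ∪ fromList s)            ≡⟨ cong rk (∪-assoc A ⁅ x ⁆ (fromList s)) ⟩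
      rk (A ∪ fromList (x ∷ s))                ≡⟨ h (refl ∷ s⊑o) ⟩
      rk A ℕ.+ (c x ℕ.+ sum (map c s))         ≡⟨ ℕ.+-assoc (rk A) (c x) _ ⟨
      rk A ℕ.+ c x ℕ.+ sum (map c s)           ≡⟨ cong (ℕ._+ sum (map c s)) gain ⟨
      rk (A ∪ ⁅ x ⁆) ℕ.+ sum (map c s)         ∎))
    where
    open ≡-Reasoning
    gain : rk (A ∪ ⁅ x ⁆) ≡ rk A ℕ.+ c x
    gain = begin
      rk (A ∪ ⁅ x ⁆)            ≡⟨ cong (λ S → rk (A ∪ S)) (∪-identityʳ ⁅ x ⁆) ⟨
      rk (A ∪ (⁅ x ⁆ ∪ ⊥))      ≡⟨ h (refl ∷ minimum o) ⟩
      rk A ℕ.+ (c x ℕ.+ 0)      ≡⟨ cong (rk A ℕ.+_) (ℕ.+-identityʳ (c x)) ⟩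
      rk A ℕ.+ c x              ∎

  -- Induction on the sublist. A kept element moves into the base. For a skipped `y`, diminishing
  -- gain gives the lower bound. The upper bound has two cases: if `c y` is 0, adding `y` does not
  -- change the rank of `A` and monotonicity suffices; otherwise all later increments are at least
  -- 1, so their sum over `s` is at least the length of `s`, which bounds the rank gain in a
  -- matroid.
  increments⇒rank-sums : ∀ A {o s} c → increments A o ≡ map c o → T (weaklyIncreasing (map suc (map c o))) →
    s ⊑ o → rank-sum A c s
  increments⇒rank-sums A c eq w [] = trans (rk-∪⊥ A) (sym (ℕ.+-identityʳ _))
  increments⇒rank-sums A {x ∷ o} {.x ∷ s} c eq w (refl ∷ s⊑o) = begin
    rk (A ∪ fromList (x ∷ s))              ≡⟨ cong rk (∪-assoc A ⁅ x ⁆ (fromList s)) ⟨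
    rk ((A ∪ ⁅ x ⁆) ∪ fromList s)
      ≡⟨ increments⇒rank-sums (A ∪ ⁅ x ⁆) c (proj₂ (∷-injective eq)) (weaklyIncreasing-tail (suc (c x)) (map suc (map c o)) w) s⊑o ⟩
    rk (A ∪ ⁅ x ⁆) ℕ.+ sum (map c s)       ≡⟨ cong (ℕ._+ sum (map c s)) (rk-∪-gain A ⁅ x ⁆) ⟨
    rk A ℕ.+ (rk (A ∪ ⁅ x ⁆) ∸ rk A) ℕ.+ sum (map c s)
      ≡⟨ cong (λ g → rk A ℕ.+ g ℕ.+ sum (map c s)) (proj₁ (∷-injective eq)) ⟩
    rk A ℕ.+ c x ℕ.+ sum (map c s)         ≡⟨ ℕ.+-assoc (rk A) (c x) _ ⟩
    rk A ℕ.+ (c x ℕ.+ sum (map c s))       ∎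
    where open ≡-Reasoning
  increments⇒rank-sums A {y ∷ o} {s} c eq w (.y ∷ʳ s⊑o) = ℕ.≤-antisym (upper (c y) refl) lower
    where
    open ℕ.≤-Reasoning
    σ : ℕ
    σ = sum (map c s)
    gain : rk (A ∪ ⁅ y ⁆) ≡ rk A ℕ.+ c y
    gain = trans (sym (rk-∪-gain A ⁅ y ⁆)) (cong (rk A ℕ.+_) (proj₁ (∷-injective eq)))
    rec : rank-sum (A ∪ ⁅ y ⁆) c s
    rec = increments⇒rank-sums (A ∪ ⁅ y ⁆) c (proj₂ (∷-injective eq)) (weaklyIncreasing-tail (suc (c y)) (map suc (map c o)) w) s⊑o
    lower : rk A ℕ.+ σ ≤ rk (A ∪ fromList s)
    -- With `rk (A ∪ ⁅ y ⁆)` added on both sides, the claim is `rk-submodular` after substitution of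
    -- `rec`.
    lower = ℕ.+-cancelˡ-≤ (rk (A ∪ ⁅ y ⁆)) _ _ (begin
      rk (A ∪ ⁅ y ⁆) ℕ.+ (rk A ℕ.+ σ)               ≡⟨ cong (rk (A ∪ ⁅ y ⁆) ℕ.+_) (ℕ.+-comm (rk A) σ) ⟩
      rk (A ∪ ⁅ y ⁆) ℕ.+ (σ ℕ.+ rk A)               ≡⟨ ℕ.+-assoc (rk (A ∪ ⁅ y ⁆)) σ (rk A) ⟨
      rk (A ∪ ⁅ y ⁆) ℕ.+ σ ℕ.+ rk A                 ≡⟨ cong (ℕ._+ rk A) rec ⟨
      rk ((A ∪ ⁅ y ⁆) ∪ fromList s) ℕ.+ rk A        ≤⟨ rk-submodular A (fromList s) ⁅ y ⁆ ⟩
      rk (A ∪ fromList s) ℕ.+ rk (A ∪ ⁅ y ⁆)        ≡⟨ ℕ.+-comm _ (rk (A ∪ ⁅ y ⁆)) ⟩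
      rk (A ∪ ⁅ y ⁆) ℕ.+ rk (A ∪ fromList s)        ∎)
    upper : ∀ k → c y ≡ k → rk (A ∪ fromList s) ≤ rk A ℕ.+ σ
    upper zero c≡0 = begin
      rk (A ∪ fromList s)
        ≤⟨ rk-mono (λ x∈ → [ p⊆p∪q (fromList s) ∘ p⊆p∪q ⁅ y ⁆ , q⊆p∪q (A ∪ ⁅ y ⁆) (fromList s) ]′ (x∈p∪q⁻ A (fromList s) x∈)) ⟩
      rk ((A ∪ ⁅ y ⁆) ∪ fromList s)  ≡⟨ rec ⟩
      rk (A ∪ ⁅ y ⁆) ℕ.+ σ           ≡⟨ cong (ℕ._+ σ) gain ⟩
      rk A ℕ.+ c y ℕ.+ σ             ≡⟨ cong (λ k → rk A ℕ.+ k ℕ.+ σ) c≡0 ⟩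
      rk A ℕ.+ 0 ℕ.+ σ               ≡⟨ cong (ℕ._+ σ) (ℕ.+-identityʳ (rk A)) ⟩
      rk A ℕ.+ σ                     ∎
    upper (suc k) c≡1+k = ℕ.≤-trans (rk-∪-fromList A s) (ℕ.+-monoʳ-≤ (rk A) (length≤sum c (All-resp-⊆ s⊑o ones)))
      where
      ones : All (λ x → 1 ≤ c x) o
      -- The predecessor undoes the shift by `suc` in the indices of the P-basis.
      ones = All.map (λ {x} cy≤cx → ℕ.≤-trans (ℕ.s≤s ℕ.z≤n) (subst (_≤ c x) c≡1+k (ℕ.≤-pred cy≤cx)))
        (All.map⁻ (All.map⁻ (weaklyIncreasing-head (suc (c y)) (map suc (map c o)) w)))

  -- `C` collects the elements with increment 1. It lies in the set already listed, so a new `x` of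
  -- increment 0 is outside it; and a new `x` of increment 1 differs from all later entries, so
  -- adding it leaves their values unchanged.
  increments-χ : ∀ A o → Unique o → ∃ λ C → C ⊆ fromList o × increments A o ≡ map (χ C) o
  increments-χ A []      []       = ⊥ , id , refl
  increments-χ A (x ∷ o) (x∉ ∷ u) with increments-χ (A ∪ ⁅ x ⁆) o u | rk (A ∪ ⁅ x ⁆) ∸ rk A in eq
  ... | C , C⊆ , rec | 0 = C , q⊆p∪q ⁅ x ⁆ (fromList o) ∘ C⊆ ,
    cong₂ _∷_ (cong (if_then 1 else 0) (sym (lookup-∉ C (λ x∈ → All.lookup x∉ (∈-fromList⁻ o (C⊆ x∈)) refl)))) rec
  ... | C , C⊆ , rec | 1 = ⁅ x ⁆ ∪ C ,
    (λ y∈ → x∈p∪q⁺ ([ inj₁ , inj₂ ∘ C⊆ ]′ (x∈p∪q⁻ ⁅ x ⁆ C y∈))) ,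
    cong₂ _∷_ (sym (χ-⁅x⁆∪ x C)) (trans rec (map-cong-local (All.map (sym ∘ χ-⁅y⁆∪ C) x∉)))
  -- Adding one element of a matroid raises the rank by at most 1.
  ... | _ | suc (suc k) = contradiction
    (subst (_≤ 1) eq (ℕ.m≤n+o⇒m∸n≤o (rk (A ∪ ⁅ x ⁆)) (rk A) (rk-∪⁅x⁆ A x))) λ { (ℕ.s≤s ()) }

  -- Minors that split into coloops and loops.

  Split : Subset n → Subset n → Subset n → Set
  Split A B C = ∀ S → S ⊆ B → rk (A ∪ S) ∸ rk A ≡ ∣ S ∩ C ∣

  module _ (A B : Subset n) where

    splitsAt : Subset n → Subset n → Bool
    splitsAt C S = if S ⊆ᵇ B then (rk (A ∪ S) ∸ rk A) ==ℕ ∣ S ∩ C ∣ else true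

    splitsAt⇒≡ : ∀ C S → T (splitsAt C S) → S ⊆ B → rk (A ∪ S) ∸ rk A ≡ ∣ S ∩ C ∣
    splitsAt⇒≡ C S t S⊆B rewrite dec-true (S ⊆? B) S⊆B = ℕ.≡ᵇ⇒≡ _ _ t

    ≡⇒splitsAt : ∀ C S → (S ⊆ B → rk (A ∪ S) ∸ rk A ≡ ∣ S ∩ C ∣) → T (splitsAt C S)
    ≡⇒splitsAt C S h with S ⊆? B
    ... | yes S⊆B = ℕ.≡⇒≡ᵇ _ _ (h S⊆B)
    ... | no _    = _

    ζ-minor⁻ : T (ζ-minor M A B) → ∃ (Split A B)
    ζ-minor⁻ t with satisfied (any⁻ _ (allSubsets n) t)
    ... | C , t′ = C , λ S → splitsAt⇒≡ C S
      (All.lookup (All.all⁺ (splitsAt C) (allSubsets n) (proj₂ (Equivalence.to (T-∧ {C ⊆ᵇ B}) t′))) (∈-allSubsets S))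

    ζ-minor⁺ : ∀ C → C ⊆ B → Split A B C → T (ζ-minor M A B)
    ζ-minor⁺ C C⊆B h = any⁺ _ (Any.map (λ { refl → Equivalence.from (T-∧ {C ⊆ᵇ B})
      ( Equivalence.from T-≡ (dec-true (C ⊆? B) C⊆B)
      , All.all⁻ (splitsAt C) {allSubsets n} (All.universal (λ S → ≡⇒splitsAt C S (h S)) (allSubsets n))) }) (∈-allSubsets C))

  -- Each sublist of `o` lists a subset of `B` without repetition, so the number of its elements in
  -- `C` is a sum of values of `χ C`, and the rank is additive along `o`.
  split⇒increments : ∀ A B C {o} → o ∈ perms (elements B) → Split A B C → increments A o ≡ map (χ C) o
  split⇒increments A B C {o} o∈ h = rank-sums⇒increments A o (χ C) (λ {s} s⊑o → begin
    rk (A ∪ fromList s)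
      ≡⟨ rk-∪-gain A (fromList s) ⟨
    rk A ℕ.+ (rk (A ∪ fromList s) ∸ rk A)
      ≡⟨ cong (rk A ℕ.+_) (h (fromList s) (λ x∈ → subst (_ ∈ˢ_) (fromList-ordering B o∈) (∈-fromList⁺ (lookup s⊑o (∈-fromList⁻ s x∈))))) ⟩
    rk A ℕ.+ ∣ fromList s ∩ C ∣
      ≡⟨ cong (rk A ℕ.+_) (∣fromList∩C∣ C (Unique-resp-⊑ s⊑o (ordering-unique B o∈))) ⟩
    rk A ℕ.+ sum (map (χ C) s) ∎)
    where open ≡-Reasoning

  -- A single sorted ordering suffices because every subset of `B` occurs as one of its sublists.
  -- The coloops are the elements with increment 1.
  weaklyIncreasing⇒ζ-minor : ∀ A B {o} → o ∈ perms (elements B) →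
    T (weaklyIncreasing (map suc (increments A o))) → T (ζ-minor M A B)
  weaklyIncreasing⇒ζ-minor A B {o} o∈ w with increments-χ A o (ordering-unique B o∈)
  ... | C , C⊆ , eq = ζ-minor⁺ A B C (subst (C ⊆_) (fromList-ordering B o∈) C⊆) split
    where
    open ≡-Reasoning
    split : Split A B C
    split S S⊆B = begin
      rk (A ∪ S) ∸ rk A
        ≡⟨ cong (λ S → rk (A ∪ S) ∸ rk A) S≡ ⟨
      rk (A ∪ fromList s) ∸ rk A
        ≡⟨ cong (_∸ rk A) (increments⇒rank-sums A (χ C) eq (subst (T ∘ weaklyIncreasing ∘ map suc) eq w) s⊑o) ⟩
      rk A ℕ.+ sum (map (χ C) s) ∸ rk A
        ≡⟨ ℕ.m+n∸m≡n (rk A) _ ⟩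
      sum (map (χ C) s)
        ≡⟨ ∣fromList∩C∣ C (Unique-resp-⊑ s⊑o (ordering-unique B o∈)) ⟨
      ∣ fromList s ∩ C ∣
        ≡⟨ cong (λ S → ∣ S ∩ C ∣) S≡ ⟩
      ∣ S ∩ C ∣ ∎
      where
      s : List (Fin n)
      -- The elements of `S` are listed in the order of `o`, so that they form a sublist of it.
      s = filter (_∈? S) o
      s⊑o : s ⊑ o
      s⊑o = filter-⊆ (_∈? S) o
      S≡ : fromList s ≡ S
      S≡ = ⊆-antisym
        (λ x∈ → proj₂ (∈-filter⁻ (_∈? S) {xs = o} (∈-fromList⁻ s x∈)))
        (λ x∈ → ∈-fromList⁺ (∈-filter⁺ (_∈? S) (∈-fromList⁻ o (subst (_ ∈ˢ_) (sym (fromList-ordering B o∈)) (S⊆B x∈))) x∈))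

  -- Sums over orderings and over flags.

  ∑-orderings-γ : ∀ A B → ∑ (perms (elements B)) (λ o → γ (map suc (increments A o))) ≡ bool→ℚ (ζ-minor M A B)
  ∑-orderings-γ A B with ζ-minor M A B in ζ≡
  -- The same `C` serves all orderings, so the increments are values of one function of the element
  -- and `∑-perms-γ` applies.
  ... | true = let C , h = ζ-minor⁻ A B (Equivalence.from T-≡ ζ≡) in trans
    (∑-cong-∈ (perms (elements B)) (λ {o} o∈ → cong γ (trans (cong (map suc) (split⇒increments A B C o∈ h)) (sym (map-∘ o)))))
    (∑-perms-γ (suc ∘ χ C) (elements B))
  ... | false = trans (∑-cong-∈ (perms (elements B)) vanish) (∑-0 (perms (elements B)) (λ _ → refl))
    where
    vanish : ∀ {o} → o ∈ perms (elements B) → γ (map suc (increments A o)) ≡ 0ℚ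
    vanish {o} o∈ with weaklyIncreasing (map suc (increments A o)) in w≡
    ... | false = refl
    ... | true  = ⊥-elim (subst T ζ≡ (weaklyIncreasing⇒ζ-minor A B o∈ (Equivalence.from T-≡ w≡)))

  -- After the cut, increments are taken over the base enlarged by the first part, so the second
  -- part sees the first only through its underlying set.
  cut-increments : ∀ a (G : List ℕ → List ℕ → ℚ) A o →
    cut a G (map suc (increments A o)) ≡
    cut a (λ p q → G (map suc (increments A p)) (map suc (increments (A ∪ fromList p) q))) o
  cut-increments zero    G A o       = cong (λ S → G [] (map suc (increments S o))) (sym (∪-identityʳ A))
  cut-increments (suc a) G A []      = refl
  cut-increments (suc a) G A (x ∷ o) = trans
    (cut-increments a (G ∘ (suc (rk (A ∪ ⁅ x ⁆) ∸ rk A) ∷_)) (A ∪ ⁅ x ⁆) o)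
    (cut-cong a (λ p q → cong (λ S → G (map suc (increments A (x ∷ p))) (map suc (increments S q))) (∪-assoc A ⁅ x ⁆ (fromList p))) o)

  -- The base `A` is the union of the blocks already chosen; it has to vary because each step of the
  -- induction on `α` adds a block to it.
  ∑-orderings-θ : ∀ α A →
    ∑ (perms (elements (∁ A))) (λ o → θ-coeff (map suc (increments A o)) α) ≡ ∑ (flags A α) (ζ-flag M A)
  ∑-orderings-θ [] A with ≡-dec Bool._≟_ A ⊤
  -- Nothing is left to order: the empty ordering and the empty flag both contribute 1.
  ... | yes refl = cong (λ l → ∑ (perms l) (λ o → θ-coeff (map suc (increments ⊤ o)) [])) (elements-∁⊤ n)
  -- No flag is left, and every ordering still has a letter that the empty composition cannot
  -- absorb.
  ... | no A≢⊤   = trans (∑-cong-∈ (perms (elements (∁ A))) (λ {o} → vanish o)) (∑-0 (perms (elements (∁ A))) (λ _ → refl))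
    where
    vanish : ∀ o → o ∈ perms (elements (∁ A)) → θ-coeff (map suc (increments A o)) [] ≡ 0ℚ
    vanish (_ ∷ _) _  = refl
    vanish []      o∈ with elements (∁ A) in eq
    ... | []    = contradiction (elements-∁≡[] A eq) A≢⊤
    ... | x ∷ l = contradiction (↭-sym (perms-↭ (x ∷ l) o∈)) ¬x∷xs↭[]
  ∑-orderings-θ (a ∷ α) A = begin
    ∑ (perms (elements (∁ A))) (λ o → θ-coeff (map suc (increments A o)) (a ∷ α))
      ≡⟨ ∑-cong (perms (elements (∁ A))) (λ o → trans (θ-coeff-∷ (map suc (increments A o)) a α)
           (cut-increments a (λ p q → γ p * θ-coeff q α) A o)) ⟩
    ∑ (perms (elements (∁ A))) (cut a G)
      ≡⟨ ∑-perms-cut a G (elements (∁ A)) ⟩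
    splitSum a (∑∑ G) (elements (∁ A))
      ≡⟨ ∑-blocks-split A a (∑∑ G) ⟨
    ∑ (blocks A a) (λ B → ∑∑ G (elements B) (elements (∁ (A ∪ B))))
      ≡⟨ ∑-cong (blocks A a) block ⟩
    ∑ (blocks A a) (λ B → ∑ (map (B ∷_) (flags (A ∪ B) α)) (ζ-flag M A))
      ≡⟨ ∑-concatMap (λ B → map (B ∷_) (flags (A ∪ B) α)) (blocks A a) (ζ-flag M A) ⟨
    ∑ (flags A (a ∷ α)) (ζ-flag M A) ∎
    where
    open ≡-Reasoning
    θ-sum : Subset n → List (Fin n) → ℚ
    θ-sum A q = θ-coeff (map suc (increments A q)) α
    G : List (Fin n) → List (Fin n) → ℚ
    G p q = γ (map suc (increments A p)) * θ-sum (A ∪ fromList p) q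
    block : ∀ B → ∑∑ G (elements B) (elements (∁ (A ∪ B))) ≡ ∑ (map (B ∷_) (flags (A ∪ B) α)) (ζ-flag M A)
    block B = begin
      ∑ (perms (elements B)) (λ p → ∑ qs (G p))
        -- All orderings `p` of the block have underlying set `B`, so the inner sum is the same for
        -- each and the double sum factors.
        ≡⟨ ∑-cong-∈ (perms (elements B)) (λ {p} p∈ → trans
             (∑-*ˡ qs (γ (map suc (increments A p))) (θ-sum (A ∪ fromList p)))
             (cong (λ S → γ (map suc (increments A p)) * ∑ qs (θ-sum (A ∪ S))) (fromList-ordering B p∈))) ⟩
      ∑ (perms (elements B)) (λ p → γ (map suc (increments A p)) * ∑ qs (θ-sum (A ∪ B)))
        ≡⟨ ∑-*ʳ (perms (elements B)) (∑ qs (θ-sum (A ∪ B))) (λ p → γ (map suc (increments A p))) ⟩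
      ∑ (perms (elements B)) (λ p → γ (map suc (increments A p))) * ∑ qs (θ-sum (A ∪ B))
        ≡⟨ cong₂ _*_ (∑-orderings-γ A B) (∑-orderings-θ α (A ∪ B)) ⟩
      bool→ℚ (ζ-minor M A B) * ∑ (flags (A ∪ B) α) (ζ-flag M (A ∪ B))
        ≡⟨ ∑-*ˡ (flags (A ∪ B) α) (bool→ℚ (ζ-minor M A B)) (ζ-flag M (A ∪ B)) ⟨
      ∑ (flags (A ∪ B) α) (λ Bs → ζ-flag M A (B ∷ Bs))
        ≡⟨ ∑-map (B ∷_) (flags (A ∪ B) α) (ζ-flag M A) ⟨
      ∑ (map (B ∷_) (flags (A ∪ B) α)) (ζ-flag M A) ∎
      where
      qs : List (List (Fin n))
      qs = perms (elements (∁ (A ∪ B)))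

theorem7p4 : ∀ {n} (M : Matroid n) (α : List ℕ) → All NonZero α →
    θ𝒢-coeff M α ≡ ℱ-coeff M α
theorem7p4 {n} M α _ = begin
  θ𝒢-coeff M α
    ≡⟨ ∑-map (λ o → map suc (increments M ⊥ o)) (perms (allFin n)) (λ β → θ-coeff β α) ⟩
  ∑ (perms (allFin n)) (λ o → θ-coeff (map suc (increments M ⊥ o)) α)
    ≡⟨ cong (λ l → ∑ (perms l) (λ o → θ-coeff (map suc (increments M ⊥ o)) α)) (elements-∁⊥ n) ⟨
  ∑ (perms (elements (∁ ⊥))) (λ o → θ-coeff (map suc (increments M ⊥ o)) α)
    ≡⟨ ∑-orderings-θ M α ⊥ ⟩
  ℱ-coeff M α ∎
  where open ≡-Reasoning
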